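{- Let $A=[a_{ij}]\in M_{m,n}(\mathbb{R})$ have rank $r>1$ and be diagonally eliminable up to $r$, and let $0\leq k<r$. Then the Gauss-Jordan operation matrix $\mathcal{G}_{2k+1}=[g^{(2k+1)}_{ij}]_{m\times m}$ satisfies $g^{(2k+1)}_{ij}=0$ for $i\neq j$, $g^{(2k+1)}_{ii}=1$ for $i\neq k+1$, and $g^{(2k+1)}_{k+1,k+1}=\dfrac{m_k}{m_{k+1}}$; and $\mathcal{G}_{2k+2}=[g^{(2k+2)}_{ij}]_{m\times m}$ satisfies $$g^{(2k+2)}_{ij}=\begin{cases}0 & \text{if } j\notin\{i,k+1\},\\ 1 & \text{if } i=j,\\ (-1)^{k+i+1}\dfrac{m^{1\dots k}_{1\dots i-1,\,i+1\dots k+1}}{m_k} & \text{if } 1\leq i\leq k,\ j=k+1,\\[2mm] -\dfrac{m^{1\dots k\,i}_{1\dots k\,k+1}}{m_k} & \text{if } k+1<i\leq m,\ j=k+1.\end{cases}$$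
   Context: Gauss-Jordan procedure: for $A\in M_{m,n}(\mathbb{R})$ set $A^{(0)}=A$. For $k\geq 0$, if $A^{(2k)}=[a^{(2k)}_{ij}]$ is defined and $a^{(2k)}_{k+1,k+1}\neq 0$, let $\mathcal{G}_{2k+1}$ be the $m\times m$ diagonal matrix with all diagonal entries $1$ except the $(k+1,k+1)$ entry, which is $1/a^{(2k)}_{k+1,k+1}$, and set $A^{(2k+1)}=\mathcal{G}_{2k+1}A^{(2k)}=[a^{(2k+1)}_{ij}]$; then let $\mathcal{G}_{2k+2}=[g_{ij}]_{m\times m}$ with $g_{ii}=1$, $g_{i,k+1}=-a^{(2k+1)}_{i,k+1}$ for $i\neq k+1$, and all other entries $0$, and set $A^{(2k+2)}=\mathcal{G}_{2k+2}A^{(2k+1)}$. The $\mathcal{G}_q$ are the Gauss-Jordan operation matrices. A matrix $A$ of rank $r\geq 1$ is diagonally eliminable up to $r$ if for each $k=1,\dots,r$ the matrix $A^{(2k-2)}$ is defined and $a^{(2k-2)}_{kk}\neq 0$. Minors: $m^{i_1\dots i_p}_{j_1\dots j_p}$ (increasing indices) is the determinant of the submatrix of $A$ with rows $i_1,\dots,i_p$ and columns $j_1,\dots,j_p$; $m^{1\dots k}_{1\dots i-1,\,i+1\dots k+1}$ uses rows $1,\dots,k$ and columns $1,\dots,k+1$ with $i$ removed. $m_k=m^{1\dots k}_{1\dots k}$ and $m_0=1$. -}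

module Defs where

open import Algebra.Apartness.Bundles using (HeytingCommutativeRing; HeytingField)
open import Algebra.Bundles using (CommutativeRing; Semiring)
open import Algebra.Apartness.Structures using (IsHeytingField)
open import Algebra.Structures using (IsAbelianGroup; IsCommutativeRing)
import Algebra.Definitions.RawSemiring as RawSemiringDefinitions
import Algebra.Properties.Ring as RingProperties
open import Data.Empty using (⊥-elim)
open import Data.Fin.Base using (Fin; zero; suc; toℕ; fromℕ<; inject≤; punchIn)
import Data.Fin.Properties as Fin
open import Data.Nat.Base as ℕ using (ℕ; zero; suc)
import Data.Nat.Properties as ℕ
open import Data.Product.Base using (Σ-syntax; ∃-syntax; _×_; _,_; proj₁; proj₂)
open import Data.Rational.Base as ℚ using (ℚ; 0ℚ; 1ℚ; ½; ∣_∣)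
import Data.Rational.Properties as ℚ
open import Data.Rational.Solver using (module +-*-Solver)
open import Data.Sum.Base as Sum using (_⊎_; inj₁; inj₂)
open import Level using (0ℓ; _⊔_)
import Relation.Binary.Reasoning.Setoid as SetoidReasoning
open import Relation.Binary.Structures using (IsEquivalence; IsApartnessRelation)
open import Relation.Binary.PropositionalEquality using (_≡_; _≢_; refl; sym; trans; cong; cong₂; subst)
open import Relation.Nullary using (Dec; yes; no; ¬_)

module CauchyReals where

  open import Data.Rational.Base using (_+_; _*_; _-_; -_; _≤_; _<_)
  open +-*-Solver using (solve; con; _:=_; _:+_; _:*_; _:-_; :-_)

  -- The real numbers: Cauchy sequences of rationals, with equality
  -- meaning that the difference tends to 0.

  Cauchy : (ℕ → ℚ) → Set
  Cauchy f = ∀ ε → 0ℚ < ε → ∃[ N ] ∀ m n → N ℕ.≤ m → N ℕ.≤ n → ∣ f m - f n ∣ < ε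

  record ℝ : Set where
    constructor mkℝ
    field
      seq    : ℕ → ℚ
      cauchy : Cauchy seq

  open ℝ public

  infix 4 _≈ᵣ_ _#ᵣ_

  record _≈ᵣ_ (x y : ℝ) : Set where
    constructor mk≈
    field
      close : ∀ ε → 0ℚ < ε → ∃[ N ] ∀ n → N ℕ.≤ n → ∣ seq x n - seq y n ∣ < ε

  open _≈ᵣ_ public

  -- The constructive form of x ≠ y: some positive rational is eventually
  -- a lower bound of ∣ x - y ∣.  Classically equivalent to ¬ (x ≈ᵣ y), and
  -- what is needed to divide by x - y.

  record _#ᵣ_ (x y : ℝ) : Set where
    constructor mk#
    field
      gap   : ℚ
      gap>0 : 0ℚ < gap
      apart : ∃[ N ] ∀ n → N ℕ.≤ n → gap ≤ ∣ seq x n - seq y n ∣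

  open _#ᵣ_ public

  private

    0<* : ∀ {p q} → 0ℚ < p → 0ℚ < q → 0ℚ < p * q
    0<* {p} {q} 0<p 0<q =
      ℚ.positive⁻¹ (p * q) {{ℚ.pos*pos⇒pos p {{ℚ.positive 0<p}} q {{ℚ.positive 0<q}}}}

    0<½ : 0ℚ < ½
    0<½ = ℚ.positive⁻¹ ½

    0<1 : 0ℚ < 1ℚ
    0<1 = ℚ.positive⁻¹ 1ℚ

    halves : ∀ ε → ε * ½ + ε * ½ ≡ ε
    halves = solve 1 (λ e → e :* con ½ :+ e :* con ½ := e) refl

    half>0 : ∀ {ε} → 0ℚ < ε → 0ℚ < ε * ½
    half>0 0<ε = 0<* 0<ε 0<½

    reciprocal : ∀ {c} → 0ℚ < c → ∃[ d ] 0ℚ < d × c * d ≡ 1ℚ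
    reciprocal {c} 0<c = ℚ.1/_ c {{ℚ.pos⇒nonZero c {{pc}}}}
      , ℚ.positive⁻¹ _ {{ℚ.1/pos⇒pos c {{pc}}}}
      , ℚ.*-inverseʳ c {{ℚ.pos⇒nonZero c {{pc}}}}
      where
      pc : ℚ.Positive c
      pc = ℚ.positive 0<c

    inv : ℚ → ℚ
    inv q with q ℚ.≟ 0ℚ
    ... | yes _   = 0ℚ
    ... | no  q≢0 = ℚ.1/_ q {{ℚ.≢-nonZero q≢0}}

    inv-inverseˡ : ∀ q → q ≢ 0ℚ → inv q * q ≡ 1ℚ
    inv-inverseˡ q q≢0 with q ℚ.≟ 0ℚ
    ... | yes q≡0 = ⊥-elim (q≢0 q≡0)
    ... | no  q≢0 = ℚ.*-inverseˡ q {{ℚ.≢-nonZero q≢0}}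

    ≤*-mono : ∀ {p q r s} → 0ℚ ≤ r → 0ℚ ≤ q → p ≤ q → r ≤ s → p * r ≤ q * s
    ≤*-mono {p} {q} {r} {s} 0≤r 0≤q p≤q r≤s = ℚ.≤-trans
      (ℚ.*-monoʳ-≤-nonNeg r {{ℚ.nonNegative 0≤r}} p≤q)
      (ℚ.*-monoˡ-≤-nonNeg q {{ℚ.nonNegative 0≤q}} r≤s)

    sub-swap : ∀ p q → ∣ p - q ∣ ≡ ∣ q - p ∣
    sub-swap p q = trans
      (cong ∣_∣ (solve 2 (λ p q → p :- q := :- (q :- p)) refl p q))
      (ℚ.∣-p∣≡∣p∣ (q - p))

    split : ∀ {p a} b c → a ≡ b + c → p ≤ ∣ a ∣ → p ≤ ∣ b ∣ + ∣ c ∣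
    split b c refl p≤ = ℚ.≤-trans p≤ (ℚ.∣p+q∣≤∣p∣+∣q∣ b c)

    -- Null sequences along an arbitrary filter base R, so that the same
    -- lemmas serve the Cauchy condition (pairs of indices) and equality.

    module Eventually {I : Set} (R : ℕ → I → Set)
                      (weaken : ∀ {M N i} → M ℕ.≤ N → R N i → R M i) where

      Null : (I → ℚ) → Set
      Null f = ∀ ε → 0ℚ < ε → ∃[ N ] ∀ i → R N i → ∣ f i ∣ < ε

      Bounded : (I → ℚ) → Set
      Bounded f = ∃[ B ] 0ℚ < B × ∃[ N ] ∀ i → R N i → ∣ f i ∣ ≤ B

      null-cong : ∀ {f g} → (∀ i → f i ≡ g i) → Null f → Null g
      null-cong f≗g nf ε 0<ε with N , p ← nf ε 0<ε =
        N , λ i r → subst (λ q → ∣ q ∣ < ε) (f≗g i) (p i r)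

      null-0 : Null (λ _ → 0ℚ)
      null-0 ε 0<ε = 0 , λ _ _ → 0<ε

      null-neg : ∀ {f} → Null f → Null (λ i → - f i)
      null-neg {f} nf ε 0<ε with N , p ← nf ε 0<ε =
        N , λ i r → subst (_< ε) (sym (ℚ.∣-p∣≡∣p∣ (f i))) (p i r)

      null-+ : ∀ {f g} → Null f → Null g → Null (λ i → f i + g i)
      null-+ {f} {g} nf ng ε 0<ε
        with M , p ← nf (ε * ½) (half>0 0<ε)
           | N , q ← ng (ε * ½) (half>0 0<ε) =
        M ℕ.⊔ N , λ i r → ℚ.≤-<-trans (ℚ.∣p+q∣≤∣p∣+∣q∣ (f i) (g i))
          (subst (∣ f i ∣ + ∣ g i ∣ <_) (halves ε)
            (ℚ.+-mono-< (p i (weaken (ℕ.m≤m⊔n M N) r))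
                        (q i (weaken (ℕ.m≤n⊔m M N) r))))

      null-* : ∀ {f g} → Bounded f → Null g → Null (λ i → f i * g i)
      null-* {f} {g} (B , 0<B , M , p) ng ε 0<ε
        with d , 0<d , Bd≡1 ← reciprocal 0<B
        with N , q ← ng (ε * d) (0<* 0<ε 0<d) =
        M ℕ.⊔ N , λ i r → subst (_< ε) (sym (ℚ.∣p*q∣≡∣p∣*∣q∣ (f i) (g i)))
          (ℚ.≤-<-trans
            (ℚ.*-monoʳ-≤-nonNeg ∣ g i ∣ {{ℚ.∣-∣-nonNeg (g i)}}
              (p i (weaken (ℕ.m≤m⊔n M N) r)))
            (subst (B * ∣ g i ∣ <_) eq
              (ℚ.*-monoʳ-<-pos B {{ℚ.positive 0<B}}
                (q i (weaken (ℕ.m≤n⊔m M N) r)))))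
        where
        eq : B * (ε * d) ≡ ε
        eq = trans (solve 3 (λ B e d → B :* (e :* d) := e :* (B :* d)) refl B ε d)
               (trans (cong (ε *_) Bd≡1) (ℚ.*-identityʳ ε))

      bounded-* : ∀ {f g} → Bounded f → Bounded g → Bounded (λ i → f i * g i)
      bounded-* {f} {g} (B , 0<B , M , p) (C , 0<C , N , q) =
        B * C , 0<* 0<B 0<C , M ℕ.⊔ N , λ i r →
          subst (_≤ B * C) (sym (ℚ.∣p*q∣≡∣p∣*∣q∣ (f i) (g i)))
            (≤*-mono (ℚ.0≤∣p∣ (g i)) (ℚ.<⇒≤ 0<B)
              (p i (weaken (ℕ.m≤m⊔n M N) r))
              (q i (weaken (ℕ.m≤n⊔m M N) r)))

    module One = Eventually {ℕ} ℕ._≤_ ℕ.≤-trans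

    Both : ℕ → ℕ × ℕ → Set
    Both N (m , n) = N ℕ.≤ m × N ℕ.≤ n

    module Two = Eventually {ℕ × ℕ} Both
      (λ M≤N (p , q) → ℕ.≤-trans M≤N p , ℕ.≤-trans M≤N q)

    diff : (ℕ → ℚ) → ℕ × ℕ → ℚ
    diff f (m , n) = f m - f n

    null₂ : (x : ℝ) → Two.Null (diff (seq x))
    null₂ x ε 0<ε with N , p ← cauchy x ε 0<ε = N , λ (m , n) (r , s) → p m n r s

    toCauchy : ∀ f → Two.Null (diff f) → Cauchy f
    toCauchy _ nf ε 0<ε = let N , p = nf ε 0<ε in N , λ m n r s → p (m , n) (r , s)

    bounded : (x : ℝ) → One.Bounded (seq x)
    bounded x with N , p ← cauchy x 1ℚ 0<1 =
      1ℚ + ∣ seq x N ∣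
      , ℚ.+-mono-<-≤ 0<1 (ℚ.0≤∣p∣ (seq x N))
      , N , λ n N≤n → ℚ.≤-trans
          (split (seq x n - seq x N) (seq x N)
            (solve 2 (λ a b → a := a :- b :+ b) refl (seq x n) (seq x N)) ℚ.≤-refl)
          (ℚ.+-monoˡ-≤ ∣ seq x N ∣ (ℚ.<⇒≤ (p n N N≤n ℕ.≤-refl)))

    bounded₁ : ∀ {f} → One.Bounded f → Two.Bounded (λ i → f (proj₁ i))
    bounded₁ (B , 0<B , N , p) = B , 0<B , N , λ i r → p (proj₁ i) (proj₁ r)

    bounded₂ : ∀ {f} → One.Bounded f → Two.Bounded (λ i → f (proj₂ i))
    bounded₂ (B , 0<B , N , p) = B , 0<B , N , λ i r → p (proj₂ i) (proj₂ r)

  abstract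
    private

      const-cauchy : ∀ q → Cauchy (λ _ → q)
      const-cauchy q = toCauchy (λ _ → q) (Two.null-cong (λ _ → sym (ℚ.+-inverseʳ q)) Two.null-0)

      +-cauchy : ∀ x y → Cauchy (λ n → seq x n + seq y n)
      +-cauchy x y = toCauchy (λ n → seq x n + seq y n) (Two.null-cong
        (λ (m , n) → solve 4 (λ a b c d → a :- b :+ (c :- d) := a :+ c :- (b :+ d)) refl
                       (seq x m) (seq x n) (seq y m) (seq y n))
        (Two.null-+ (null₂ x) (null₂ y)))

      neg-cauchy : ∀ x → Cauchy (λ n → - seq x n)
      neg-cauchy x = toCauchy (λ n → - seq x n) (Two.null-cong
        (λ (m , n) → solve 2 (λ a b → :- (a :- b) := :- a :- :- b) refl (seq x m) (seq x n))
        (Two.null-neg (null₂ x)))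

      *-cauchy : ∀ x y → Cauchy (λ n → seq x n * seq y n)
      *-cauchy x y = toCauchy (λ n → seq x n * seq y n) (Two.null-cong
        (λ (m , n) → solve 4 (λ a b c d → a :* (c :- d) :+ d :* (a :- b) := a :* c :- b :* d) refl
                       (seq x m) (seq x n) (seq y m) (seq y n))
        (Two.null-+ (Two.null-* (bounded₁ (bounded x)) (null₂ y))
                    (Two.null-* (bounded₂ (bounded y)) (null₂ x))))

  infixl 6 _+ᵣ_
  infixl 7 _*ᵣ_
  infix  8 -ᵣ_

  fromℚ : ℚ → ℝ
  fromℚ q = mkℝ (λ _ → q) (const-cauchy q)

  0ᵣ 1ᵣ : ℝ
  0ᵣ = fromℚ 0ℚ
  1ᵣ = fromℚ 1ℚ

  _+ᵣ_ : ℝ → ℝ → ℝ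
  x +ᵣ y = mkℝ (λ n → seq x n + seq y n) (+-cauchy x y)

  -ᵣ_ : ℝ → ℝ
  -ᵣ x = mkℝ (λ n → - seq x n) (neg-cauchy x)

  _*ᵣ_ : ℝ → ℝ → ℝ
  x *ᵣ y = mkℝ (λ n → seq x n * seq y n) (*-cauchy x y)

  private

    pointwise : ∀ {x y} → (∀ n → seq x n ≡ seq y n) → x ≈ᵣ y
    pointwise {x} {y} eq = mk≈ (One.null-cong
      (λ n → sym (trans (cong (_- seq y n) (eq n)) (ℚ.+-inverseʳ (seq y n)))) One.null-0)

    ≈-sym : ∀ {x y} → x ≈ᵣ y → y ≈ᵣ x
    ≈-sym {x} {y} (mk≈ p) = mk≈ (One.null-cong
      (λ n → solve 2 (λ a b → :- (a :- b) := b :- a) refl (seq x n) (seq y n))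
      (One.null-neg p))

    ≈-trans : ∀ {x y z} → x ≈ᵣ y → y ≈ᵣ z → x ≈ᵣ z
    ≈-trans {x} {y} {z} (mk≈ p) (mk≈ q) = mk≈ (One.null-cong
      (λ n → solve 3 (λ a b c → a :- b :+ (b :- c) := a :- c) refl (seq x n) (seq y n) (seq z n))
      (One.null-+ p q))

    +-cong : ∀ {x y u v} → x ≈ᵣ y → u ≈ᵣ v → x +ᵣ u ≈ᵣ y +ᵣ v
    +-cong {x} {y} {u} {v} (mk≈ p) (mk≈ q) = mk≈ (One.null-cong
      (λ n → solve 4 (λ a b c d → a :- b :+ (c :- d) := a :+ c :- (b :+ d)) refl
               (seq x n) (seq y n) (seq u n) (seq v n))
      (One.null-+ p q))

    *-cong : ∀ {x y u v} → x ≈ᵣ y → u ≈ᵣ v → x *ᵣ u ≈ᵣ y *ᵣ v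
    *-cong {x} {y} {u} {v} (mk≈ p) (mk≈ q) = mk≈ (One.null-cong
      (λ n → solve 4 (λ a b c d → a :* (c :- d) :+ d :* (a :- b) := a :* c :- b :* d) refl
               (seq x n) (seq y n) (seq u n) (seq v n))
      (One.null-+ (One.null-* (bounded x) q) (One.null-* (bounded v) p)))

    neg-cong : ∀ {x y} → x ≈ᵣ y → -ᵣ x ≈ᵣ -ᵣ y
    neg-cong {x} {y} (mk≈ p) = mk≈ (One.null-cong
      (λ n → solve 2 (λ a b → :- (a :- b) := :- a :- :- b) refl (seq x n) (seq y n))
      (One.null-neg p))

    #-irrefl : ∀ {x y} → x ≈ᵣ y → ¬ (x #ᵣ y)
    #-irrefl (mk≈ p) (mk# ε 0<ε (M , q)) with N , p′ ← p ε 0<ε =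
      ℚ.<-irrefl refl (ℚ.≤-<-trans (q (M ℕ.⊔ N) (ℕ.m≤m⊔n M N)) (p′ (M ℕ.⊔ N) (ℕ.m≤n⊔m M N)))

    #-sym : ∀ {x y} → x #ᵣ y → y #ᵣ x
    #-sym {x} {y} (mk# ε 0<ε (N , p)) =
      mk# ε 0<ε (N , λ n r → subst (ε ≤_) (sub-swap (seq x n) (seq y n)) (p n r))

    tri : ∀ a b → ∣ a ∣ ≤ ∣ a - b ∣ + ∣ b ∣
    tri a b = split (a - b) b (solve 2 (λ a b → a := a :- b :+ b) refl a b) ℚ.≤-refl

    small-or-large : (z : ℝ) → ∀ ε → 0ℚ < ε →
      (∃[ N ] ∀ n → N ℕ.≤ n → ∣ seq z n ∣ < ε) ⊎
      (∃[ η ] 0ℚ < η × ∃[ N ] ∀ n → N ℕ.≤ n → η ≤ ∣ seq z n ∣)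
    small-or-large (mkℝ d c) ε 0<ε with N , p ← c (ε * ½ * ½) (half>0 (half>0 0<ε)) =
      result (∣ d N ∣ ℚ.<? ε * ½)
      where
      η : ℚ
      η = ε * ½ * ½
      0<η : 0ℚ < η
      0<η = half>0 (half>0 0<ε)
      η≤½ε : η ≤ ε * ½
      η≤½ε = subst (η ≤_) (halves (ε * ½))
        (subst (_≤ η + η) (ℚ.+-identityʳ η) (ℚ.+-monoʳ-≤ η (ℚ.<⇒≤ 0<η)))
      result : Dec (∣ d N ∣ < ε * ½) →
        (∃[ N ] ∀ n → N ℕ.≤ n → ∣ d n ∣ < ε) ⊎
        (∃[ η ] 0ℚ < η × ∃[ N ] ∀ n → N ℕ.≤ n → η ≤ ∣ d n ∣)
      result (yes small) = inj₁ (N , λ n r → ℚ.≤-<-trans (tri (d n) (d N))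
        (subst (∣ d n - d N ∣ + ∣ d N ∣ <_) (halves ε)
          (ℚ.+-mono-< (ℚ.<-≤-trans (p n N r ℕ.≤-refl) η≤½ε) small)))
      result (no large) = inj₂ (η , 0<η , N , λ n r → ℚ.≮⇒≥ λ lt → large
        (ℚ.≤-<-trans (tri (d N) (d n))
          (subst (∣ d N - d n ∣ + ∣ d n ∣ <_) (halves (ε * ½))
            (ℚ.+-mono-< (p N n ℕ.≤-refl r) lt))))

    close-or-apart : ∀ x y ε → 0ℚ < ε →
      (∃[ N ] ∀ n → N ℕ.≤ n → ∣ seq x n - seq y n ∣ < ε) ⊎ (x #ᵣ y)
    close-or-apart x y ε 0<ε = Sum.map
      (λ p → p) (λ (η , 0<η , p) → mk# η 0<η p) (small-or-large (x +ᵣ (-ᵣ y)) ε 0<ε)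

    tri-< : ∀ {ε} a b c → ∣ a - b ∣ < ε * ½ → ε ≤ ∣ a - c ∣ → ε * ½ ≤ ∣ b - c ∣
    tri-< {ε} a b c ab ac = ℚ.≮⇒≥ λ bc → ℚ.<-irrefl refl (ℚ.≤-<-trans
      (split (a - b) (b - c)
        (solve 3 (λ a b c → a :- c := a :- b :+ (b :- c)) refl a b c) ac)
      (subst (∣ a - b ∣ + ∣ b - c ∣ <_) (halves ε) (ℚ.+-mono-< ab bc)))

    #-cotrans : ∀ {x y} → x #ᵣ y → ∀ z → (x #ᵣ z) ⊎ (z #ᵣ y)
    #-cotrans {x} {y} (mk# ε 0<ε (M , p)) z = Sum.swap (Sum.map₁
      (λ (N , q) → mk# (ε * ½) (half>0 0<ε) (M ℕ.⊔ N , λ n r →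
        tri-< (seq x n) (seq z n) (seq y n)
          (q n (ℕ.≤-trans (ℕ.m≤n⊔m M N) r)) (p n (ℕ.≤-trans (ℕ.m≤m⊔n M N) r))))
      (close-or-apart x z (ε * ½) (half>0 0<ε)))

    #-tight : ∀ x y → (¬ (x #ᵣ y) → x ≈ᵣ y) × (x ≈ᵣ y → ¬ (x #ᵣ y))
    #-tight x y = to , #-irrefl
      where
      to : ¬ (x #ᵣ y) → x ≈ᵣ y
      to ¬x#y = mk≈ λ ε 0<ε →
        Sum.fromInj₁ (λ x#y → ⊥-elim (¬x#y x#y)) (close-or-apart x y ε 0<ε)

    module Inverse (z : ℝ) (ε : ℚ) (0<ε : 0ℚ < ε) (M : ℕ)
                   (p : ∀ n → M ℕ.≤ n → ε ≤ ∣ seq z n ∣) where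

      i : ℕ → ℚ
      i n = inv (seq z n)

      nonzero : ∀ n → M ℕ.≤ n → seq z n ≢ 0ℚ
      nonzero n r eq = ℚ.<-irrefl refl
        (ℚ.<-≤-trans 0<ε (subst (λ q → ε ≤ ∣ q ∣) eq (p n r)))

      i*z≡1 : ∀ n → M ℕ.≤ n → i n * seq z n ≡ 1ℚ
      i*z≡1 n r = inv-inverseˡ (seq z n) (nonzero n r)

      boundᵢ : One.Bounded i
      boundᵢ with d , 0<d , εd≡1 ← reciprocal 0<ε =
        d , 0<d , M , λ n r → ℚ.*-cancelʳ-≤-pos ε {{ℚ.positive 0<ε}} (ℚ.≤-trans
          (ℚ.*-monoˡ-≤-nonNeg ∣ i n ∣ {{ℚ.∣-∣-nonNeg (i n)}} (p n r))
          (ℚ.≤-reflexive (trans (sym (ℚ.∣p*q∣≡∣p∣*∣q∣ (i n) (seq z n)))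
            (trans (cong ∣_∣ (i*z≡1 n r)) (sym (trans (ℚ.*-comm d ε) εd≡1))))))

      i-diff : ∀ m n → M ℕ.≤ m → M ℕ.≤ n → i m * i n * - (seq z m - seq z n) ≡ i m - i n
      i-diff m n r s = trans
        (solve 4 (λ a b u v → a :* b :* :- (u :- v) := a :* (b :* v) :- b :* (a :* u)) refl
          (i m) (i n) (seq z m) (seq z n))
        (cong₂ _-_ (trans (cong (i m *_) (i*z≡1 n s)) (ℚ.*-identityʳ (i m)))
                   (trans (cong (i n *_) (i*z≡1 m r)) (ℚ.*-identityʳ (i n))))

      i-cauchy : Cauchy i
      i-cauchy = toCauchy i i-null
        where
        i-null : Two.Null (diff i)
        i-null δ 0<δ = M ℕ.⊔ N , λ (m , n) (r , s) → subst (λ q → ∣ q ∣ < δ)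
            (i-diff m n (ℕ.≤-trans (ℕ.m≤m⊔n M N) r) (ℕ.≤-trans (ℕ.m≤m⊔n M N) s))
            (proj₂ eventual (m , n) (ℕ.≤-trans (ℕ.m≤n⊔m M N) r , ℕ.≤-trans (ℕ.m≤n⊔m M N) s))
          where
          eventual : ∃[ N ] ∀ i′ → Both N i′ →
            ∣ i (proj₁ i′) * i (proj₂ i′) * - diff (seq z) i′ ∣ < δ
          eventual = Two.null-* (Two.bounded-* (bounded₁ boundᵢ) (bounded₂ boundᵢ))
                       (Two.null-neg (null₂ z)) δ 0<δ
          N : ℕ
          N = proj₁ eventual

      z⁻¹ : ℝ
      z⁻¹ = mkℝ i i-cauchy

      inverseˡ : z⁻¹ *ᵣ z ≈ᵣ 1ᵣ
      inverseˡ = mk≈ λ δ 0<δ → M , λ n r →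
        subst (λ q → ∣ q - 1ℚ ∣ < δ) (sym (i*z≡1 n r)) 0<δ

    *-comm : ∀ x y → x *ᵣ y ≈ᵣ y *ᵣ x
    *-comm x y = pointwise λ n → ℚ.*-comm (seq x n) (seq y n)

    #⇒invertible : ∀ {x y} → x #ᵣ y →
      ∃[ w ] (w *ᵣ (x +ᵣ (-ᵣ y)) ≈ᵣ 1ᵣ) × ((x +ᵣ (-ᵣ y)) *ᵣ w ≈ᵣ 1ᵣ)
    #⇒invertible {x} {y} (mk# ε 0<ε (M , p)) =
      z⁻¹ , inverseˡ , ≈-trans (*-comm (x +ᵣ (-ᵣ y)) z⁻¹) inverseˡ
      where open Inverse (x +ᵣ (-ᵣ y)) ε 0<ε M p

    lower : ∀ {B c} w d → 0ℚ < B → B * c ≡ 1ℚ →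
            ∣ w ∣ ≤ B → ∣ w * d - 1ℚ ∣ < ½ → ½ * c ≤ ∣ d ∣
    lower {B} {c} w d 0<B Bc≡1 wb h = ℚ.≮⇒≥ λ lt → ℚ.<-irrefl refl (ℚ.≤-<-trans
      (split {p = 1ℚ} {a = 1ℚ} (w * d) (- (w * d - 1ℚ))
        (solve 1 (λ a → con 1ℚ := a :+ :- (a :- con 1ℚ)) refl (w * d)) ℚ.≤-refl)
      (ℚ.+-mono-< (small lt) (subst (_< ½) (sym (ℚ.∣-p∣≡∣p∣ (w * d - 1ℚ))) h)))
      where
      eq : B * (½ * c) ≡ ½
      eq = trans (solve 2 (λ B c → B :* (con ½ :* c) := con ½ :* (B :* c)) refl B c)
                 (cong (½ *_) Bc≡1)
      small : ∣ d ∣ < ½ * c → ∣ w * d ∣ < ½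
      small lt = subst (_< ½) (sym (ℚ.∣p*q∣≡∣p∣*∣q∣ w d))
        (ℚ.≤-<-trans
          (ℚ.*-monoʳ-≤-nonNeg ∣ d ∣ {{ℚ.∣-∣-nonNeg d}} wb)
          (subst (B * ∣ d ∣ <_) eq (ℚ.*-monoʳ-<-pos B {{ℚ.positive 0<B}} lt)))

    invertible⇒# : ∀ {x y} →
      (∃[ w ] (w *ᵣ (x +ᵣ (-ᵣ y)) ≈ᵣ 1ᵣ) × ((x +ᵣ (-ᵣ y)) *ᵣ w ≈ᵣ 1ᵣ)) → x #ᵣ y
    invertible⇒# {x} {y} (w , mk≈ e , _) = result (bounded w) (e ½ 0<½)
      where
      result : One.Bounded (seq w) →
        (∃[ N ] ∀ n → N ℕ.≤ n → ∣ seq w n * (seq x n - seq y n) - 1ℚ ∣ < ½) → x #ᵣ y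
      result (B , 0<B , M , b) (N , q) = below (reciprocal 0<B)
        where
        below : (∃[ c ] 0ℚ < c × B * c ≡ 1ℚ) → x #ᵣ y
        below (c , 0<c , Bc≡1) = mk# (½ * c) (0<* 0<½ 0<c) (M ℕ.⊔ N , λ n r →
          lower (seq w n) (seq x n - seq y n) 0<B Bc≡1
            (b n (ℕ.≤-trans (ℕ.m≤m⊔n M N) r)) (q n (ℕ.≤-trans (ℕ.m≤n⊔m M N) r)))

  private

    ≈-refl : ∀ {x} → x ≈ᵣ x
    ≈-refl = pointwise λ _ → refl

    +-assoc : ∀ x y z → x +ᵣ y +ᵣ z ≈ᵣ x +ᵣ (y +ᵣ z)
    +-assoc x y z = pointwise λ n → ℚ.+-assoc (seq x n) (seq y n) (seq z n)

    +-comm : ∀ x y → x +ᵣ y ≈ᵣ y +ᵣ x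
    +-comm x y = pointwise λ n → ℚ.+-comm (seq x n) (seq y n)

    +-identityˡ : ∀ x → 0ᵣ +ᵣ x ≈ᵣ x
    +-identityˡ x = pointwise λ n → ℚ.+-identityˡ (seq x n)

    +-identityʳ : ∀ x → x +ᵣ 0ᵣ ≈ᵣ x
    +-identityʳ x = pointwise λ n → ℚ.+-identityʳ (seq x n)

    +-inverseˡ : ∀ x → -ᵣ x +ᵣ x ≈ᵣ 0ᵣ
    +-inverseˡ x = pointwise λ n → ℚ.+-inverseˡ (seq x n)

    +-inverseʳ : ∀ x → x +ᵣ -ᵣ x ≈ᵣ 0ᵣ
    +-inverseʳ x = pointwise λ n → ℚ.+-inverseʳ (seq x n)

    *-assoc : ∀ x y z → x *ᵣ y *ᵣ z ≈ᵣ x *ᵣ (y *ᵣ z)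
    *-assoc x y z = pointwise λ n → ℚ.*-assoc (seq x n) (seq y n) (seq z n)

    *-identityˡ : ∀ x → 1ᵣ *ᵣ x ≈ᵣ x
    *-identityˡ x = pointwise λ n → ℚ.*-identityˡ (seq x n)

    *-identityʳ : ∀ x → x *ᵣ 1ᵣ ≈ᵣ x
    *-identityʳ x = pointwise λ n → ℚ.*-identityʳ (seq x n)

    *-distribˡ-+ : ∀ x y z → x *ᵣ (y +ᵣ z) ≈ᵣ x *ᵣ y +ᵣ x *ᵣ z
    *-distribˡ-+ x y z = pointwise λ n → ℚ.*-distribˡ-+ (seq x n) (seq y n) (seq z n)

    *-distribʳ-+ : ∀ x y z → (y +ᵣ z) *ᵣ x ≈ᵣ y *ᵣ x +ᵣ z *ᵣ x
    *-distribʳ-+ x y z = pointwise λ n → ℚ.*-distribʳ-+ (seq x n) (seq y n) (seq z n)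

  ℝ-isEquivalence : IsEquivalence _≈ᵣ_
  ℝ-isEquivalence = record { refl = ≈-refl ; sym = ≈-sym ; trans = ≈-trans }

  ℝ-+-isAbelianGroup : IsAbelianGroup _≈ᵣ_ _+ᵣ_ 0ᵣ -ᵣ_
  ℝ-+-isAbelianGroup = record
    { isGroup = record
      { isMonoid = record
        { isSemigroup = record
          { isMagma = record { isEquivalence = ℝ-isEquivalence ; ∙-cong = +-cong }
          ; assoc = +-assoc }
        ; identity = +-identityˡ , +-identityʳ }
      ; inverse = +-inverseˡ , +-inverseʳ
      ; ⁻¹-cong = neg-cong }
    ; comm = +-comm }

  ℝ-isCommutativeRing : IsCommutativeRing _≈ᵣ_ _+ᵣ_ _*ᵣ_ -ᵣ_ 0ᵣ 1ᵣ
  ℝ-isCommutativeRing = record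
    { isRing = record
      { +-isAbelianGroup = ℝ-+-isAbelianGroup
      ; *-cong = *-cong
      ; *-assoc = *-assoc
      ; *-identity = *-identityˡ , *-identityʳ
      ; distrib = *-distribˡ-+ , *-distribʳ-+ }
    ; *-comm = *-comm }

  ℝ-isApartnessRelation : IsApartnessRelation _≈ᵣ_ _#ᵣ_
  ℝ-isApartnessRelation = record
    { irrefl = #-irrefl ; sym = #-sym ; cotrans = #-cotrans }

  ℝ-isHeytingField : IsHeytingField _≈ᵣ_ _#ᵣ_ _+ᵣ_ _*ᵣ_ -ᵣ_ 0ᵣ 1ᵣ
  ℝ-isHeytingField = record
    { isHeytingCommutativeRing = record
      { isCommutativeRing   = ℝ-isCommutativeRing
      ; isApartnessRelation = ℝ-isApartnessRelation
      ; #⇒invertible        = #⇒invertible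
      ; invertible⇒#        = invertible⇒# }
    ; tight = #-tight }

  ℝ-heytingField : HeytingField 0ℓ 0ℓ 0ℓ
  ℝ-heytingField = record { isHeytingField = ℝ-isHeytingField }

module LinearAlgebra {c ℓ₁ ℓ₂} (F : HeytingField c ℓ₁ ℓ₂) where

  open HeytingField F hiding (zero) renaming (refl to ≈-refl)
  open CommutativeRing (HeytingCommutativeRing.commutativeRing heytingCommutativeRing)
    using (semiring; ring)
  open RawSemiringDefinitions (Semiring.rawSemiring semiring) public using (sum; _^_)

  -- The library gives an inverse of x - 0# rather than of x;
  -- *-reciprocal shows that this makes no difference.

  reciprocal : (x : Carrier) → x # 0# → Carrier
  reciprocal x x#0 = proj₁ (#⇒invertible x#0)

  infixl 7 _÷_[_]

  _÷_[_] : (x y : Carrier) → y # 0# → Carrier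
  x ÷ y [ y#0 ] = x * reciprocal y y#0

  *-reciprocal : ∀ x x#0 → x * reciprocal x x#0 ≈ 1#
  *-reciprocal x x#0 = begin
    x * reciprocal x x#0         ≈⟨ *-cong (+-identityʳ x) ≈-refl ⟨
    (x + 0#) * reciprocal x x#0  ≈⟨ *-cong (+-cong ≈-refl -0#≈0#) ≈-refl ⟨
    (x - 0#) * reciprocal x x#0  ≈⟨ proj₂ (proj₂ (#⇒invertible x#0)) ⟩
    1#                           ∎
    where
    open SetoidReasoning setoid
    open RingProperties ring using (-0#≈0#)

  Matrix : ℕ → ℕ → Set c
  Matrix m n = Fin m → Fin n → Carrier

  infixl 7 _·_

  _·_ : ∀ {l m n} → Matrix l m → Matrix m n → Matrix l n
  (A · B) i j = sum (λ k → A i k * B k j)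

  -- Laplace expansion along the first row.

  det : ∀ {n} → Matrix n n → Carrier
  det {zero}  A = 1#
  det {suc n} A = sum (λ j →
    (- 1#) ^ toℕ j * (A zero j * det (λ s t → A (suc s) (punchIn j t))))

  -- The minor of A with rows ρ 0, ρ 1, … and columns γ 0, γ 1, ….

  minor : ∀ {m n p} → Matrix m n → (Fin p → Fin m) → (Fin p → Fin n) → Carrier
  minor A ρ γ = det (λ s t → A (ρ s) (γ t))

  -- The index list 1, …, p inside 1, …, n.

  leading : ∀ {p n} → p ℕ.≤ n → Fin p → Fin n
  leading p≤n i = inject≤ i p≤n

  -- m_p; for p = 0 this is the empty determinant 1#.

  leadingMinor : ∀ {m n p} → Matrix m n → p ℕ.≤ m → p ℕ.≤ n → Carrier
  leadingMinor A p≤m p≤n = minor A (leading p≤m) (leading p≤n)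

  combination : ∀ {r m} → (Fin r → Carrier) → (Fin r → Fin m → Carrier) → Fin m → Carrier
  combination x v i = sum (λ j → x j * v j i)

  InSpan : ∀ {r m} → (Fin r → Fin m → Carrier) → (Fin m → Carrier) → Set (c ⊔ ℓ₁)
  InSpan v w = ∃[ x ] ∀ i → w i ≈ combination x v i

  LinearlyIndependent : ∀ {r m} → (Fin r → Fin m → Carrier) → Set (c ⊔ ℓ₁)
  LinearlyIndependent v = ∀ x → (∀ i → combination x v i ≈ 0#) → ∀ j → x j ≈ 0#

  columns : ∀ {m n} → Matrix m n → Fin n → Fin m → Carrier
  columns A j i = A i j

  -- The column space of A has dimension r.

  record HasRank {m n} (A : Matrix m n) (r : ℕ) : Set (c ⊔ ℓ₁) where
    field
      basis         : Fin r → Fin m → Carrier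
      inColumnSpace : ∀ j → InSpan (columns A) (basis j)
      independent   : LinearlyIndependent basis
      spanning      : ∀ j → InSpan basis (columns A j)

  -- Indices are 0-based: the informal entry (k+1 , k+1) is the entry
  -- (k , k) here.  That entry must exist as well as be nonzero.

  record Pivot {m n} (B : Matrix m n) (k : ℕ) : Set ℓ₂ where
    field
      k<m     : k ℕ.< m
      k<n     : k ℕ.< n
    row : Fin m
    row = fromℕ< k<m
    col : Fin n
    col = fromℕ< k<n
    field
      nonzero : B row col # 0#

  open Pivot public using (k<m; k<n; row; col)

  scaling : ∀ {m n k} {B : Matrix m n} → Pivot B k → Matrix m m
  scaling {B = B} p i j with i Fin.≟ j | i Fin.≟ row p
  ... | no  _ | _     = 0#
  ... | yes _ | no  _ = 1#
  ... | yes _ | yes _ = 1# ÷ B (row p) (col p) [ Pivot.nonzero p ]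

  clearing : ∀ {m n} → Matrix m n → Fin m → Fin n → Matrix m m
  clearing C κ κ′ i j with i Fin.≟ j | j Fin.≟ κ
  ... | yes _ | _     = 1#
  ... | no  _ | yes _ = - C i κ′
  ... | no  _ | no  _ = 0#

  -- Defined A k says that A^(2k) is defined, and even is then A^(2k).
  -- For d : Defined A k and p : Pivot (even d) k,
  --   𝒢₂ₖ₊₁ d p, 𝒢₂ₖ₊₂ d p  are the operation matrices 𝒢_{2k+1}, 𝒢_{2k+2},
  --   odd d p               is A^(2k+1).

  data Defined {m n} (A : Matrix m n) : ℕ → Set ℓ₂

  even : ∀ {m n} {A : Matrix m n} {k} → Defined A k → Matrix m n

  data Defined A where
    start : Defined A 0
    step  : ∀ {k} (d : Defined A k) → Pivot (even d) k → Defined A (suc k)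

  𝒢₂ₖ₊₁ : ∀ {m n} {A : Matrix m n} {k} (d : Defined A k) → Pivot (even d) k → Matrix m m
  odd   : ∀ {m n} {A : Matrix m n} {k} (d : Defined A k) → Pivot (even d) k → Matrix m n
  𝒢₂ₖ₊₂ : ∀ {m n} {A : Matrix m n} {k} (d : Defined A k) → Pivot (even d) k → Matrix m m

  even {A = A} start = A
  even (step d p)    = 𝒢₂ₖ₊₂ d p · odd d p

  𝒢₂ₖ₊₁ d p = scaling p
  odd d p   = 𝒢₂ₖ₊₁ d p · even d
  𝒢₂ₖ₊₂ d p = clearing (odd d p) (row p) (col p)

  -- The index k here is k-1 in the informal definition.

  DiagonallyEliminable : ∀ {m n} → Matrix m n → ℕ → Set ℓ₂
  DiagonallyEliminable A r = ∀ k → k ℕ.< r → Σ[ d ∈ Defined A k ] Pivot (even d) k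

{-# OPTIONS --safe #-}

-- Write B = A⁽²ᵏ⁾.  By induction on k, A = E B, where E consists of the
-- first k columns of A followed by the last m - k columns of the identity.
-- In column k+1 this says that, up to entries below row k which are exactly
-- those of B, the column is the combination of the first k columns of A with
-- coefficients B₁,ₖ₊₁, …, Bₖ,ₖ₊₁.  Hence Cramer's rule gives the entries of
-- column k+1 of B in rows 1 … k, and expanding the bordered minors along
-- their last column gives those below.  In particular mₖ₊₁ is mₖ times the
-- pivot, so all the leading minors involved are nonzero.

module Submission where

open import Defs
open import Algebra.Apartness.Bundles using (HeytingCommutativeRing; HeytingField)
import Algebra.Apartness.Properties.HeytingCommutativeRing as HeytingCommutativeRingProperties
open import Algebra.Bundles using (CommutativeRing)
import Algebra.Properties.Ring as RingProperties
import Algebra.Properties.Semiring.Exp as Exp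
import Algebra.Properties.Semiring.Sum as Sum
import Algebra.Solver.Ring.NaturalCoefficients.Default as SemiringSolver
open import Data.Fin.Base using (Fin; zero; suc; toℕ; fromℕ; fromℕ<; inject≤; punchIn; punchOut)
import Data.Fin.Properties as Fin
open import Data.Nat.Base using (ℕ; zero; suc; _≤_; _<_; s≤s⁻¹) renaming (_+_ to _+ℕ_)
import Data.Nat.Properties as ℕ
open import Data.Nat.Properties using (<⇒≤; m<n⇒m<1+n)
open import Data.Product.Base using (Σ-syntax; _×_; _,_)
open import Data.Sum.Base using (inj₁; inj₂)
open import Data.Vec.Functional using (_∷_; insertAt; removeAt)
open import Function.Base using (_∘_)
open import Relation.Binary.PropositionalEquality as ≡ using (_≡_; _≢_)
import Relation.Binary.Reasoning.Setoid as SetoidReasoning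
open import Relation.Nullary using (yes; no; contradiction)
open CauchyReals using (ℝ-heytingField)

-- Index lists with a distinguished last entry

punchIn-fromℕ-comm : ∀ {n} (i : Fin (suc n)) (t : Fin n) →
  punchIn (punchIn (fromℕ (suc n)) i) (punchIn (fromℕ n) t) ≡ punchIn (fromℕ (suc n)) (punchIn i t)
punchIn-fromℕ-comm zero    t       = ≡.refl
punchIn-fromℕ-comm (suc i) zero    = ≡.refl
punchIn-fromℕ-comm (suc i) (suc t) = ≡.cong suc (punchIn-fromℕ-comm i t)

punchIn-punchIn-fromℕ : ∀ {n} (i : Fin (suc n)) →
  punchIn (punchIn (fromℕ (suc n)) i) (fromℕ n) ≡ fromℕ (suc n)
punchIn-punchIn-fromℕ         zero    = ≡.refl
punchIn-punchIn-fromℕ {suc n} (suc i) = ≡.cong suc (punchIn-punchIn-fromℕ i)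

toℕ-punchIn-fromℕ : ∀ {n} (t : Fin n) → toℕ (punchIn (fromℕ n) t) ≡ toℕ t
toℕ-punchIn-fromℕ zero    = ≡.refl
toℕ-punchIn-fromℕ (suc t) = ≡.cong suc (toℕ-punchIn-fromℕ t)

inject≤-punchIn-fromℕ : ∀ {k n} .(k<n : k < n) .(k≤n : k ≤ n) (t : Fin k) →
  inject≤ (punchIn (fromℕ k) t) k<n ≡ inject≤ t k≤n
inject≤-punchIn-fromℕ k<n k≤n t = Fin.toℕ-injective (≡.trans (Fin.toℕ-inject≤ _ k<n)
  (≡.trans (toℕ-punchIn-fromℕ t) (≡.sym (Fin.toℕ-inject≤ t k≤n))))

inject≤-fromℕ : ∀ {k n} .(k<n : k < n) → inject≤ (fromℕ k) k<n ≡ fromℕ< k<n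
inject≤-fromℕ {k} k<n = Fin.toℕ-injective (≡.trans (Fin.toℕ-inject≤ _ k<n)
  (≡.trans (Fin.toℕ-fromℕ k) (≡.sym (Fin.toℕ-fromℕ< k<n))))

insertAt-fromℕ : ∀ {a} {X : Set a} {k} (xs : Fin k → X) x → insertAt xs (fromℕ k) x (fromℕ k) ≡ x
insertAt-fromℕ {k = zero}  xs x = ≡.refl
insertAt-fromℕ {k = suc k} xs x = insertAt-fromℕ (xs ∘ suc) x

insertAt-punchIn-fromℕ : ∀ {a} {X : Set a} {k} (xs : Fin k → X) x t →
  insertAt xs (fromℕ k) x (punchIn (fromℕ k) t) ≡ xs t
insertAt-punchIn-fromℕ xs x zero    = ≡.refl
insertAt-punchIn-fromℕ xs x (suc t) = insertAt-punchIn-fromℕ (xs ∘ suc) x t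

-- Signs, finite sums and Laplace sums

module Determinants {c ℓ₁ ℓ₂} (F : HeytingField c ℓ₁ ℓ₂) where

  open HeytingField F using (Carrier; _≈_; _+_; _*_; -_; _-_; 0#; 1#; heytingCommutativeRing)
  open CommutativeRing (HeytingCommutativeRing.commutativeRing heytingCommutativeRing)
    hiding (zero; Carrier; _≈_; _+_; _*_; -_; _-_; 0#; 1#)
  open LinearAlgebra F
  open RingProperties ring using (-1*x≈-x; -‿involutive)
  open Sum semiring hiding (sum)
  open SemiringSolver commutativeSemiring using (solve; con; _:=_; _:+_; _:*_)
  open SetoidReasoning setoid

  -- Treating the sign as an atom turns signed identities into commutative semiring identities, to
  -- be combined with `ε*ε≈1`.
  ε : Carrier
  ε = - 1#

  ε*ε≈1 : ε * ε ≈ 1#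
  ε*ε≈1 = trans (-1*x≈-x ε) (-‿involutive 1#)

  x+εx≈0 : ∀ x → x + ε * x ≈ 0#
  x+εx≈0 x = trans (+-congˡ (-1*x≈-x x)) (-‿inverseʳ x)

  ε^n*ε^n≈1 : ∀ n → ε ^ n * ε ^ n ≈ 1#
  ε^n*ε^n≈1 zero    = *-identityˡ 1#
  ε^n*ε^n≈1 (suc n) = begin
    ε * ε ^ n * (ε * ε ^ n)    ≈⟨ solve 2 (λ e s → e :* s :* (e :* s) := e :* e :* (s :* s)) refl ε (ε ^ n) ⟩
    ε * ε * (ε ^ n * ε ^ n)    ≈⟨ *-cong ε*ε≈1 (ε^n*ε^n≈1 n) ⟩
    1# * 1#                    ≈⟨ *-identityˡ 1# ⟩
    1#                         ∎

  -- A power of `ε` is its own inverse, so it can be moved across an equation.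
  ε^n-cancel : ∀ n {x y} → ε ^ n * x ≈ y → x ≈ ε ^ n * y
  ε^n-cancel n {x} {y} eq = begin
    x                        ≈⟨ *-identityˡ x ⟨
    1# * x                   ≈⟨ *-congʳ (ε^n*ε^n≈1 n) ⟨
    ε ^ n * ε ^ n * x        ≈⟨ *-assoc _ _ x ⟩
    ε ^ n * (ε ^ n * x)      ≈⟨ *-congˡ eq ⟩
    ε ^ n * y                ∎

  sum-zero : ∀ {n} {f : Fin n → Carrier} → (∀ i → f i ≈ 0#) → sum f ≈ 0#
  sum-zero {n} f≈0 = trans (sum-cong-≋ f≈0) (sum-replicate-zero n)

  sum-single : ∀ {n} (f : Fin n → Carrier) i → (∀ t → t ≢ i → f t ≈ 0#) → sum f ≈ f i
  sum-single {suc n} f i f≈0 = begin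
    sum f                      ≈⟨ sum-remove {i = i} f ⟩
    f i + sum (removeAt f i)   ≈⟨ +-congˡ (sum-zero (λ t → f≈0 _ (Fin.punchInᵢ≢i i t))) ⟩
    f i + 0#                   ≈⟨ +-identityʳ (f i) ⟩
    f i                        ∎

  sum-pair : ∀ {n} (f : Fin n → Carrier) i j → i ≢ j →
    (∀ t → t ≢ i → t ≢ j → f t ≈ 0#) → sum f ≈ f i + f j
  sum-pair {suc n} f i j i≢j f≈0 = begin
    sum f                      ≈⟨ sum-remove {i = i} f ⟩
    f i + sum (removeAt f i)   ≈⟨ +-congˡ (sum-single _ (punchOut i≢j) λ t t≢ →
                                    f≈0 _ (Fin.punchInᵢ≢i i t) λ eq →
                                    t≢ (Fin.punchIn-injective i _ _
                                      (≡.trans eq (≡.sym (Fin.punchIn-punchOut i≢j))))) ⟩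
    f i + removeAt f i (punchOut i≢j) ≡⟨ ≡.cong (λ t → f i + f t) (Fin.punchIn-punchOut i≢j) ⟩
    f i + f j                  ∎

  -- The determinant of a nonempty matrix unfolds to this sum, taken over its first row and the
  -- matching minors; `det-expand-column` gives the same shape for the first column.
  laplace : ∀ {n} → (Fin n → Carrier) → (Fin n → Carrier) → Carrier
  laplace a x = sum (λ i → ε ^ toℕ i * (a i * x i))

  laplace-cong : ∀ {n} {a b x y : Fin n → Carrier} →
    (∀ i → a i ≈ b i) → (∀ i → x i ≈ y i) → laplace a x ≈ laplace b y
  laplace-cong {a = a} {b} {x} {y} a≈b x≈y =
    sum-cong-≋ {x = λ i → ε ^ toℕ i * (a i * x i)} {y = λ i → ε ^ toℕ i * (b i * y i)}
      λ i → *-congˡ {ε ^ toℕ i} (*-cong (a≈b i) (x≈y i))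

  laplace-congʳ : ∀ {n} (a : Fin n → Carrier) {x y : Fin n → Carrier} →
    (∀ i → x i ≈ y i) → laplace a x ≈ laplace a y
  laplace-congʳ a = laplace-cong {a = a} (λ _ → refl)

  laplace-zeroˡ : ∀ {n} (x : Fin n → Carrier) → laplace (λ _ → 0#) x ≈ 0#
  laplace-zeroˡ x = sum-zero λ i → trans (*-congˡ (zeroˡ (x i))) (zeroʳ (ε ^ toℕ i))

  laplace-zeroʳ : ∀ {n} (a : Fin n → Carrier) → laplace a (λ _ → 0#) ≈ 0#
  laplace-zeroʳ a = sum-zero λ i → trans (*-congˡ (zeroʳ (a i))) (zeroʳ (ε ^ toℕ i))

  laplace-+ˡ : ∀ {n} (a b x : Fin n → Carrier) →
    laplace (λ i → a i + b i) x ≈ laplace a x + laplace b x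
  laplace-+ˡ a b x = trans
    (sum-cong-≋ λ i → solve 4 (λ p a b x → p :* ((a :+ b) :* x) := p :* (a :* x) :+ p :* (b :* x))
      refl (ε ^ toℕ i) (a i) (b i) (x i))
    (∑-distrib-+ (λ i → ε ^ toℕ i * (a i * x i)) (λ i → ε ^ toℕ i * (b i * x i)))

  laplace-*ˡ : ∀ {n} c (a x : Fin n → Carrier) → laplace (λ i → a i * c) x ≈ laplace a x * c
  laplace-*ˡ c a x = trans
    (sum-cong-≋ λ i → solve 4 (λ p a c x → p :* (a :* c :* x) := p :* (a :* x) :* c)
      refl (ε ^ toℕ i) (a i) c (x i))
    (sym (*-distribʳ-sum c (λ i → ε ^ toℕ i * (a i * x i))))

  laplace-*ʳ : ∀ {n} c (a x : Fin n → Carrier) → laplace a (λ i → c * x i) ≈ c * laplace a x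
  laplace-*ʳ c a x = trans
    (sum-cong-≋ λ i → solve 4 (λ p a c x → p :* (a :* (c :* x)) := c :* (p :* (a :* x)))
      refl (ε ^ toℕ i) (a i) c (x i))
    (sym (*-distribˡ-sum c (λ i → ε ^ toℕ i * (a i * x i))))

  -- Transposition and expansion along the first column

  det-cong : ∀ {n} {A B : Matrix n n} → (∀ s t → A s t ≈ B s t) → det A ≈ det B
  det-cong {zero}  A≈B = refl
  det-cong {suc n} A≈B = laplace-cong (A≈B zero) λ j →
    det-cong λ s t → A≈B (suc s) (punchIn j t)

  det-transpose : ∀ {n} (A : Matrix n n) → det A ≈ det (λ s t → A t s)
  det-transpose {zero}        A = refl
  det-transpose {suc zero}    A = refl
  -- Expanding the minors of the first-row expansion along their first
  -- columns gives a double sum that is symmetric under transposition.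
  det-transpose {suc (suc n)} A = +-cong (*-congˡ (*-congˡ (det-transpose (λ s t → A (suc s) (suc t))))) (begin
    sum (λ j → ε ^ toℕ (suc j) * (A zero (suc j) * det (λ s t → A (suc s) (punchIn (suc j) t))))
      ≈⟨ expand A (λ j → det-transpose (λ s t → A (suc s) (punchIn (suc j) t))) ⟩
    sum (λ j → sum (λ i → term A j i))
      ≈⟨ ∑-comm (term A) ⟩
    sum (λ i → sum (λ j → term A j i))
      ≈⟨ sum-cong-≋ (λ i → sum-cong-≋ λ j → flip-term i j) ⟩
    sum (λ i → sum (λ j → term (λ s t → A t s) i j))
      ≈⟨ expand (λ s t → A t s) (λ i → det-transpose (λ s t → A (punchIn (suc i) t) (suc s))) ⟨
    sum (λ i → ε ^ toℕ (suc i) * (A (suc i) zero * det (λ s t → A (punchIn (suc i) t) (suc s)))) ∎)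
    where
    term : Matrix (suc (suc n)) (suc (suc n)) → Fin (suc n) → Fin (suc n) → Carrier
    term A j i = ε ^ suc (toℕ j) * (A zero (suc j) * (ε ^ toℕ i * (A (suc i) zero *
      det (λ s t → A (suc (punchIn i t)) (suc (punchIn j s))))))

    expand : ∀ A →
      (∀ j → det (λ s t → A (suc s) (punchIn (suc j) t)) ≈ det (λ s t → A (suc t) (punchIn (suc j) s))) →
      sum (λ j → ε ^ toℕ (suc j) * (A zero (suc j) * det (λ s t → A (suc s) (punchIn (suc j) t))))
      ≈ sum (λ j → sum (λ i → term A j i))
    expand A transposed = sum-cong-≋ {y = λ j → sum (term A j)} λ j →
      let x = λ i → ε ^ toℕ i * (A (suc i) zero * det (λ s t → A (suc (punchIn i t)) (suc (punchIn j s)))) in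
      trans (*-congˡ (trans
        (*-congˡ (transposed j))
        (*-distribˡ-sum (A zero (suc j)) x)))
      (*-distribˡ-sum (ε ^ suc (toℕ j)) (λ i → A zero (suc j) * x i))

    -- The signs multiply to `ε` to the power 1 + i + j on both sides; the remaining minor, two
    -- sizes smaller, is transposed by recursion.
    flip-term : ∀ i j → term A j i ≈ term (λ s t → A t s) i j
    flip-term i j = trans
      (*-congˡ (*-congˡ (*-congˡ (*-congˡ
        (det-transpose (λ s t → A (suc (punchIn i t)) (suc (punchIn j s))))))))
      (solve 6 (λ e p q a b d → e :* p :* (a :* (q :* (b :* d))) := e :* q :* (b :* (p :* (a :* d))))
        refl ε (ε ^ toℕ j) (ε ^ toℕ i) (A zero (suc j)) (A (suc i) zero) _)

  -- This is the row expansion of the transpose, with each minor transposed back.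
  det-expand-column : ∀ {n} (A : Matrix (suc n) (suc n)) →
    det A ≈ laplace (λ i → A i zero) (λ i → det (λ s t → A (punchIn i s) (suc t)))
  det-expand-column A = trans (det-transpose A)
    (laplace-congʳ (λ i → A i zero) λ i → det-transpose (λ s t → A (punchIn i t) (suc s)))

  -- The alternating property for a column placed in front

  infixr 5 _▹_

  -- Column operations are carried out on a column in front, where the first-column expansion is
  -- available; other positions are reached through `det-move-to-front`.
  _▹_ : ∀ {m n} → (Fin m → Carrier) → Matrix m n → Matrix m (suc n)
  (v ▹ C) s = v s ∷ C s

  ▹-cong : ∀ {m n} {u v : Fin m → Carrier} {B C : Matrix m n} →
    (∀ s → u s ≈ v s) → (∀ s t → B s t ≈ C s t) → ∀ s t → (u ▹ B) s t ≈ (v ▹ C) s t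
  ▹-cong u≈v B≈C s zero    = u≈v s
  ▹-cong u≈v B≈C s (suc t) = B≈C s t

  first▹rest : ∀ {m n} (A : Matrix m (suc n)) s t →
    A s t ≈ ((λ s → A s zero) ▹ (λ s t → A s (suc t))) s t
  first▹rest A s zero    = refl
  first▹rest A s (suc t) = refl

  det-expand-▹ : ∀ {n} (v : Fin (suc n) → Carrier) (C : Matrix (suc n) n) →
    det (v ▹ C) ≈ laplace v (λ i → det (C ∘ punchIn i))
  det-expand-▹ v C = det-expand-column (v ▹ C)

  private
    minor₁ : ∀ {m n} (u v : Fin m → Carrier) (C : Matrix m n) s t →
      (u ▹ v ▹ C) s (punchIn (suc zero) t) ≈ (u ▹ C) s t
    minor₁ u v C s zero    = refl
    minor₁ u v C s (suc t) = refl

    minor₂₊ : ∀ {m n} (u v : Fin m → Carrier) (C : Matrix m (suc n)) j s t →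
      (u ▹ v ▹ C) s (punchIn (suc (suc j)) t) ≈ (u ▹ v ▹ (λ s → removeAt (C s) j)) s t
    minor₂₊ u v C j s zero          = refl
    minor₂₊ u v C j s (suc zero)    = refl
    minor₂₊ u v C j s (suc (suc t)) = refl

  -- In the expansion along the first row, the terms of `u` and `v` trade places and hence signs.
  -- Every other minor loses a column of `C` and still begins with `u` and `v`, so recursion applies
  -- to it.
  det-▹-swap : ∀ {n} (u v : Fin (suc (suc n)) → Carrier) (C : Matrix (suc (suc n)) n) →
    det (u ▹ v ▹ C) ≈ ε * det (v ▹ u ▹ C)
  det-▹-swap {n} u v C = begin
    1# * (u zero * P) + (ε * 1# * (v zero * det (λ s t → (u ▹ v ▹ C) (suc s) (punchIn (suc zero) t))) + sum S)
      -- The leading sign 1 becomes `ε * ε`, so that a factor `ε` can be taken out of every term.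
      ≈⟨ +-cong (*-congʳ (sym ε*ε≈1)) (+-cong
           (*-congˡ (*-congˡ (det-cong (minor₁ (u ∘ suc) (v ∘ suc) (C ∘ suc))))) S≈εS′) ⟩
    ε * ε * (u zero * P) + (ε * 1# * (v zero * Q) + ε * sum S′)
      ≈⟨ solve 4 (λ e p q s → e :* e :* p :+ (e :* con 1 :* q :+ e :* s)
                           := e :* (con 1 :* q :+ (e :* con 1 :* p :+ s)))
           refl ε (u zero * P) (v zero * Q) (sum S′) ⟩
    ε * (1# * (v zero * Q) + (ε * 1# * (u zero * P) + sum S′))
      ≈⟨ *-congˡ (+-congˡ (+-congʳ (*-congˡ (*-congˡ (det-cong (minor₁ (v ∘ suc) (u ∘ suc) (C ∘ suc))))))) ⟨
    ε * det (v ▹ u ▹ C) ∎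
    where
    P Q : Carrier
    P = det ((v ▹ C) ∘ suc)
    Q = det ((u ▹ C) ∘ suc)
    S S′ : Fin n → Carrier
    S j = ε ^ toℕ (suc (suc j)) * (C zero j * det (λ s t → (u ▹ v ▹ C) (suc s) (punchIn (suc (suc j)) t)))
    S′ j = ε ^ toℕ (suc (suc j)) * (C zero j * det (λ s t → (v ▹ u ▹ C) (suc s) (punchIn (suc (suc j)) t)))

    swapped : ∀ {n} (u v : Fin (suc (suc n)) → Carrier) (C : Matrix (suc (suc n)) n) j →
      det (λ s t → (u ▹ v ▹ C) (suc s) (punchIn (suc (suc j)) t))
      ≈ ε * det (λ s t → (v ▹ u ▹ C) (suc s) (punchIn (suc (suc j)) t))
    swapped {suc n} u v C j = begin
      det (λ s t → (u ▹ v ▹ C) (suc s) (punchIn (suc (suc j)) t))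
        ≈⟨ det-cong (minor₂₊ (u ∘ suc) (v ∘ suc) (C ∘ suc) j) ⟩
      det ((u ∘ suc) ▹ (v ∘ suc) ▹ (λ s → removeAt (C (suc s)) j))
        ≈⟨ det-▹-swap (u ∘ suc) (v ∘ suc) (λ s → removeAt (C (suc s)) j) ⟩
      ε * det ((v ∘ suc) ▹ (u ∘ suc) ▹ (λ s → removeAt (C (suc s)) j))
        ≈⟨ *-congˡ (det-cong (minor₂₊ (v ∘ suc) (u ∘ suc) (C ∘ suc) j)) ⟨
      ε * det (λ s t → (v ▹ u ▹ C) (suc s) (punchIn (suc (suc j)) t)) ∎

    S≈εS′ : sum S ≈ ε * sum S′
    S≈εS′ = trans
      (sum-cong-≋ λ j → trans (*-congˡ (*-congˡ (swapped u v C j)))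
        (solve 4 (λ e p a d → p :* (a :* (e :* d)) := e :* (p :* (a :* d))) refl
          ε (ε ^ toℕ (suc (suc j))) (C zero j) _))
      (sym (*-distribˡ-sum ε S′))

  -- Swapping the equal columns would only show that the determinant equals its own negative, which
  -- is inconclusive in characteristic 2. Instead the first row is expanded again: the first two
  -- terms cancel, and the others vanish by recursion.
  det-▹-double : ∀ {n} (v : Fin (suc (suc n)) → Carrier) (C : Matrix (suc (suc n)) n) →
    det (v ▹ v ▹ C) ≈ 0#
  det-▹-double {n} v C = begin
    1# * (v zero * P) + (ε * 1# * (v zero * det (λ s t → (v ▹ v ▹ C) (suc s) (punchIn (suc zero) t))) + sum S)
      ≈⟨ +-congˡ (+-cong
           (*-congˡ (*-congˡ (det-cong (minor₁ (v ∘ suc) (v ∘ suc) (C ∘ suc))))) (sum-zero (vanishes v C))) ⟩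
    1# * (v zero * P) + (ε * 1# * (v zero * P) + 0#)
      ≈⟨ solve 2 (λ e p → con 1 :* p :+ (e :* con 1 :* p :+ con 0) := p :+ e :* p) refl ε (v zero * P) ⟩
    v zero * P + ε * (v zero * P)
      ≈⟨ x+εx≈0 (v zero * P) ⟩
    0# ∎
    where
    P : Carrier
    P = det ((v ▹ C) ∘ suc)
    S : Fin n → Carrier
    S j = ε ^ toℕ (suc (suc j)) * (C zero j * det (λ s t → (v ▹ v ▹ C) (suc s) (punchIn (suc (suc j)) t)))

    vanishes : ∀ {n} (v : Fin (suc (suc n)) → Carrier) (C : Matrix (suc (suc n)) n) j →
      ε ^ toℕ (suc (suc j)) * (C zero j * det (λ s t → (v ▹ v ▹ C) (suc s) (punchIn (suc (suc j)) t))) ≈ 0#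
    vanishes {suc n} v C j = trans
      (*-congˡ (trans
        (*-congˡ (trans
          (det-cong (minor₂₊ (v ∘ suc) (v ∘ suc) (C ∘ suc) j))
          (det-▹-double (v ∘ suc) (λ s → removeAt (C (suc s)) j))))
        (zeroʳ _)))
      (zeroʳ _)

  -- If the copy of `v` is not adjacent, `v` is swapped past the first column of `C`. Expanding
  -- along that column leaves minors in which the copy is one place closer.
  det-▹-repeat : ∀ {n} (v : Fin (suc n) → Carrier) (C : Matrix (suc n) n) j →
    (∀ s → v s ≈ C s j) → det (v ▹ C) ≈ 0#
  det-▹-repeat v C zero v≈ = trans
    (det-cong (▹-cong {u = v} {v = v} (λ _ → refl) λ s t →
      trans (first▹rest C s t) (▹-cong {B = λ s t → C s (suc t)} (λ s → sym (v≈ s)) (λ _ _ → refl) s t)))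
    (det-▹-double v (λ s t → C s (suc t)))
  det-▹-repeat v C (suc j) v≈ = begin
    det (v ▹ C)               ≈⟨ det-cong (▹-cong {u = v} {v = v} (λ _ → refl) (first▹rest C)) ⟩
    det (v ▹ c₀ ▹ C′)         ≈⟨ det-▹-swap v c₀ C′ ⟩
    ε * det (c₀ ▹ v ▹ C′)     ≈⟨ *-congˡ (det-expand-▹ c₀ (v ▹ C′)) ⟩
    ε * laplace c₀ (λ i → det ((v ▹ C′) ∘ punchIn i))
                              ≈⟨ *-congˡ (laplace-congʳ c₀ λ i →
                                   det-▹-repeat (v ∘ punchIn i) (C′ ∘ punchIn i) j (v≈ ∘ punchIn i)) ⟩
    ε * laplace c₀ (λ _ → 0#) ≈⟨ *-congˡ (laplace-zeroʳ c₀) ⟩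
    ε * 0#                    ≈⟨ zeroʳ ε ⟩
    0#                        ∎
    where
    c₀ = λ s → C s zero
    C′ = λ s t → C s (suc t)

  -- Each column passed costs one `ε`. After one swap, the expansion along the old first column
  -- reduces the rest of the move to the minors.
  det-move-to-front : ∀ {n} (A : Matrix (suc n) (suc n)) i →
    det ((λ s → A s i) ▹ (λ s → removeAt (A s) i)) ≈ ε ^ toℕ i * det A
  det-move-to-front A zero = trans (sym (det-cong (first▹rest A))) (sym (*-identityˡ _))
  det-move-to-front {suc n} A (suc i) = begin
    det (v ▹ (λ s → removeAt (A s) (suc i)))
      ≈⟨ det-cong (▹-cong {u = v} {v = v} (λ _ → refl) (first▹rest (λ s → removeAt (A s) (suc i)))) ⟩
    det (v ▹ a₀ ▹ R)
      ≈⟨ det-▹-swap v a₀ R ⟩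
    ε * det (a₀ ▹ v ▹ R)
      ≈⟨ *-congˡ (det-expand-▹ a₀ (v ▹ R)) ⟩
    ε * laplace a₀ (λ s → det ((v ▹ R) ∘ punchIn s))
      ≈⟨ *-congˡ (laplace-congʳ a₀ λ s → det-move-to-front (A′ ∘ punchIn s) i) ⟩
    ε * laplace a₀ (λ s → ε ^ toℕ i * det (A′ ∘ punchIn s))
      ≈⟨ *-congˡ (laplace-*ʳ (ε ^ toℕ i) a₀ (λ s → det (A′ ∘ punchIn s))) ⟩
    ε * (ε ^ toℕ i * laplace a₀ (λ s → det (A′ ∘ punchIn s)))
      ≈⟨ *-assoc ε _ _ ⟨
    ε ^ toℕ (suc i) * laplace a₀ (λ s → det (A′ ∘ punchIn s))
      ≈⟨ *-congˡ (det-expand-column A) ⟨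
    ε ^ toℕ (suc i) * det A ∎
    where
    v = λ s → A s (suc i)
    a₀ = λ s → A s zero
    A′ = λ s t → A s (suc t)
    R = λ s → removeAt (A′ s) i

  -- Linearity in the first column, bordered determinants and Cramer's rule

  det-▹-+ : ∀ {n} (u v : Fin (suc n) → Carrier) (C : Matrix (suc n) n) →
    det ((λ s → u s + v s) ▹ C) ≈ det (u ▹ C) + det (v ▹ C)
  det-▹-+ u v C = trans (det-expand-▹ (λ s → u s + v s) C)
    (trans (laplace-+ˡ u v (λ i → det (C ∘ punchIn i)))
      (sym (+-cong (det-expand-▹ u C) (det-expand-▹ v C))))

  det-▹-* : ∀ {n} (v : Fin (suc n) → Carrier) x (C : Matrix (suc n) n) →
    det ((λ s → v s * x) ▹ C) ≈ det (v ▹ C) * x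
  det-▹-* v x C = trans (det-expand-▹ (λ s → v s * x) C)
    (trans (laplace-*ˡ x v (λ i → det (C ∘ punchIn i))) (*-congʳ (sym (det-expand-▹ v C))))

  det-▹-0 : ∀ {n} (C : Matrix (suc n) n) → det ((λ _ → 0#) ▹ C) ≈ 0#
  det-▹-0 C = trans (det-expand-▹ (λ _ → 0#) C) (laplace-zeroˡ (λ i → det (C ∘ punchIn i)))

  det-▹-sum : ∀ {n r} (V : Matrix (suc n) r) (x : Fin r → Carrier) (C : Matrix (suc n) n) →
    det ((λ s → sum (λ t → V s t * x t)) ▹ C) ≈ sum (λ t → det ((λ s → V s t) ▹ C) * x t)
  det-▹-sum {r = zero}  V x C = det-▹-0 C
  det-▹-sum {r = suc r} V x C = begin
    det ((λ s → V s zero * x zero + sum (λ t → V s (suc t) * x (suc t))) ▹ C)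
      ≈⟨ det-▹-+ (λ s → V s zero * x zero) (λ s → sum (λ t → V s (suc t) * x (suc t))) C ⟩
    _ ≈⟨ +-cong (det-▹-* (λ s → V s zero) (x zero) C) (det-▹-sum (λ s t → V s (suc t)) (x ∘ suc) C) ⟩
    sum (λ t → det ((λ s → V s t) ▹ C) * x t) ∎

  -- By linearity the front column splits into multiples of the columns of `A`. All of these except
  -- column `i` still occur among the remaining columns, so only the term with `x i` survives.
  det-▹-combination : ∀ {n} (A : Matrix (suc n) (suc n)) (x : Fin (suc n) → Carrier) i →
    det ((λ s → sum (λ t → A s t * x t)) ▹ (λ s → removeAt (A s) i)) ≈ ε ^ toℕ i * det A * x i
  det-▹-combination A x i = begin
    det ((λ s → sum (λ t → A s t * x t)) ▹ R)
      ≈⟨ det-▹-sum A x R ⟩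
    sum (λ t → det ((λ s → A s t) ▹ R) * x t)
      ≈⟨ sum-single (λ t → det ((λ s → A s t) ▹ R) * x t) i (λ t t≢i → trans
           (*-congʳ (det-▹-repeat (λ s → A s t) R (punchOut (t≢i ∘ ≡.sym)) λ s →
             reflexive (≡.cong (A s) (≡.sym (Fin.punchIn-punchOut (t≢i ∘ ≡.sym))))))
           (zeroˡ (x t))) ⟩
    det ((λ s → A s i) ▹ R) * x i
      ≈⟨ *-congʳ (det-move-to-front A i) ⟩
    ε ^ toℕ i * det A * x i ∎
    where R = λ s → removeAt (A s) i

  det-▹-drop-combination : ∀ {n} (C : Matrix (suc n) n) (x : Fin n → Carrier) w →
    det ((λ s → sum (λ t → C s t * x t) + w s) ▹ C) ≈ det (w ▹ C)
  det-▹-drop-combination C x w = begin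
    det ((λ s → sum (λ t → C s t * x t) + w s) ▹ C)
      ≈⟨ det-▹-+ (λ s → sum (λ t → C s t * x t)) w C ⟩
    det ((λ s → sum (λ t → C s t * x t)) ▹ C) + det (w ▹ C)
      ≈⟨ +-congʳ (trans (det-▹-sum C x C)
           (sum-zero λ t → trans (*-congʳ (det-▹-repeat (λ s → C s t) C t λ _ → refl)) (zeroˡ (x t)))) ⟩
    0# + det (w ▹ C)
      ≈⟨ +-identityˡ _ ⟩
    det (w ▹ C) ∎

  -- Subtracting the combination with coefficients `x` from the last column leaves zeros above the
  -- corner and `β` in it. Expanding along that column then gives a single term.
  det-bordered : ∀ {k} (N : Matrix (suc k) (suc k)) (x : Fin k → Carrier) β →
    let last = fromℕ k in
    (∀ s → N (punchIn last s) last ≈ sum (λ t → N (punchIn last s) (punchIn last t) * x t)) →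
    N last last ≈ sum (λ t → N last (punchIn last t) * x t) + β →
    det N ≈ det (λ s t → N (punchIn last s) (punchIn last t)) * β
  det-bordered {k} N x β above corner = begin
    det N
      ≈⟨ ε^n-cancel (toℕ last) (sym (det-move-to-front N last)) ⟩
    ε ^ toℕ last * det ((λ s → N s last) ▹ C)
      ≈⟨ *-congˡ (det-cong (▹-cong {C = C} split (λ _ _ → refl))) ⟩
    ε ^ toℕ last * det ((λ s → sum (λ t → C s t * x t) + w s) ▹ C)
      ≈⟨ *-congˡ (det-▹-drop-combination C x w) ⟩
    ε ^ toℕ last * det (w ▹ C)
      ≈⟨ *-congˡ (trans (det-expand-▹ w C) (sum-single _ last other)) ⟩
    ε ^ toℕ last * (ε ^ toℕ last * (w last * D))
      -- One sign comes from moving the column to the front, the other from the position of its only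
      -- nonzero entry; they cancel.
      ≈⟨ ε^n-cancel (toℕ last) refl ⟨
    w last * D
      ≈⟨ trans (*-comm (w last) D) (*-congˡ w-last) ⟩
    D * β ∎
    where
    last = fromℕ k
    C = λ s → removeAt (N s) last
    D = det (C ∘ punchIn last)
    w : Fin (suc k) → Carrier
    w s = N s last - sum (λ t → C s t * x t)

    split : ∀ s → N s last ≈ sum (λ t → C s t * x t) + w s
    split s = sym (trans (+-comm _ (w s)) (trans (+-assoc _ _ _)
      (trans (+-congˡ (-‿inverseˡ _)) (+-identityʳ (N s last)))))

    w-last : w last ≈ β
    w-last = trans (+-congʳ (trans corner (+-comm _ β)))
      (trans (+-assoc β _ _) (trans (+-congˡ (-‿inverseʳ _)) (+-identityʳ β)))

    w-above : ∀ s → s ≢ last → w s ≈ 0#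
    w-above s s≢ = ≡.subst (λ s → w s ≈ 0#) (Fin.punchIn-punchOut (s≢ ∘ ≡.sym))
      (trans (+-congʳ (above (punchOut (s≢ ∘ ≡.sym)))) (-‿inverseʳ _))

    other : ∀ s → s ≢ last → ε ^ toℕ s * (w s * det (C ∘ punchIn s)) ≈ 0#
    other s s≢ = trans (*-congˡ (trans (*-congʳ (w-above s s≢)) (zeroˡ _))) (zeroʳ _)

  -- After column `i` is deleted, the right-hand side stands in the last place, `fromℕ n`. Bringing
  -- it to the front costs `ε ^ n`, and `det-▹-combination` then picks out `x i`.
  cramer : ∀ {n} (N : Matrix (suc n) (suc (suc n))) (x : Fin (suc n) → Carrier) →
    let last = fromℕ (suc n) in
    (∀ s → N s last ≈ sum (λ t → N s (punchIn last t) * x t)) →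
    ∀ i → det (λ s → removeAt (N s) (punchIn last i))
          ≈ ε ^ n * (ε ^ toℕ i * det (λ s → removeAt (N s) last) * x i)
  cramer {n} N x solution i = ε^n-cancel n (begin
    ε ^ n * det M
      ≡⟨ ≡.cong (λ p → ε ^ p * det M) (Fin.toℕ-fromℕ n) ⟨
    ε ^ toℕ (fromℕ n) * det M
      ≈⟨ det-move-to-front M (fromℕ n) ⟨
    det ((λ s → M s (fromℕ n)) ▹ (λ s → removeAt (M s) (fromℕ n)))
      -- Deleting column `i` and then the last one leaves the same columns as deleting the last one
      -- first.
      ≈⟨ det-cong (▹-cong
           (λ s → trans (reflexive (≡.cong (N s) (punchIn-punchIn-fromℕ i))) (solution s))
           (λ s t → reflexive (≡.cong (N s) (punchIn-fromℕ-comm i t)))) ⟩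
    det ((λ s → sum (λ t → A s t * x t)) ▹ (λ s → removeAt (A s) i))
      ≈⟨ det-▹-combination A x i ⟩
    ε ^ toℕ i * det A * x i ∎)
    where
    M = λ s → removeAt (N s) (punchIn (fromℕ (suc n)) i)
    A = λ s → removeAt (N s) (fromℕ (suc n))

module GaussJordan {c ℓ₁ ℓ₂} (F : HeytingField c ℓ₁ ℓ₂) where

  open HeytingField F using (Carrier; _≈_; _+_; _*_; -_; _-_; 0#; 1#; _#_; heytingCommutativeRing)
  open CommutativeRing (HeytingCommutativeRing.commutativeRing heytingCommutativeRing)
    hiding (zero; Carrier; _≈_; _+_; _*_; -_; _-_; 0#; 1#)
  open LinearAlgebra F
  open Determinants F
  open HeytingCommutativeRingProperties heytingCommutativeRing using (1#0; x#0y#0→xy#0; #-congʳ)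
  open RingProperties ring using (-1*x≈-x; -‿distribˡ-*)
  open Exp semiring using (^-homo-*)
  open Sum semiring hiding (sum)
  open SemiringSolver commutativeSemiring using (solve; con; _:=_; _:+_; _:*_)
  open SetoidReasoning setoid

  -- The operation matrices and their action on rows

  module _ {m n k} {B : Matrix m n} (p : Pivot B k) where

    private
      pivot : Carrier
      pivot = B (row p) (col p)

      pivot⁻¹ : Carrier
      pivot⁻¹ = reciprocal pivot (Pivot.nonzero p)

    scaling-offDiagonal : ∀ i j → i ≢ j → scaling p i j ≈ 0#
    scaling-offDiagonal i j i≢j with i Fin.≟ j | i Fin.≟ row p
    ... | no  _   | _ = refl
    ... | yes i≡j | _ = contradiction i≡j i≢j

    scaling-diagonal : ∀ i → i ≢ row p → scaling p i i ≈ 1#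
    scaling-diagonal i i≢κ with i Fin.≟ i | i Fin.≟ row p
    ... | no  i≢i | _       = contradiction ≡.refl i≢i
    ... | yes _   | no  _   = refl
    ... | yes _   | yes i≡κ = contradiction i≡κ i≢κ

    scaling-pivot : scaling p (row p) (row p) ≈ pivot⁻¹
    scaling-pivot with row p Fin.≟ row p | row p Fin.≟ row p
    ... | no  κ≢κ | _       = contradiction ≡.refl κ≢κ
    ... | yes _   | no  κ≢κ = contradiction ≡.refl κ≢κ
    ... | yes _   | yes _   = *-identityˡ pivot⁻¹

    private
      scaling-row : ∀ i j → (scaling p · B) i j ≈ scaling p i i * B i j
      scaling-row i j = sum-single _ i λ t t≢i →
        trans (*-congʳ (scaling-offDiagonal i t (t≢i ∘ ≡.sym))) (zeroˡ (B t j))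

    scaled-other : ∀ i j → i ≢ row p → (scaling p · B) i j ≈ B i j
    scaled-other i j i≢κ = trans (scaling-row i j) (trans (*-congʳ (scaling-diagonal i i≢κ)) (*-identityˡ (B i j)))

    -- Written with the pivot as a factor, this undoes the scaling and keeps the reciprocal out of
    -- later equations.
    pivot*scaled : ∀ j → pivot * (scaling p · B) (row p) j ≈ B (row p) j
    pivot*scaled j = begin
      pivot * (scaling p · B) (row p) j       ≈⟨ *-congˡ (trans (scaling-row (row p) j) (*-congʳ scaling-pivot)) ⟩
      pivot * (pivot⁻¹ * B (row p) j)         ≈⟨ *-assoc _ _ _ ⟨
      pivot * pivot⁻¹ * B (row p) j           ≈⟨ *-congʳ (*-reciprocal pivot _) ⟩
      1# * B (row p) j                        ≈⟨ *-identityˡ _ ⟩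
      B (row p) j                             ∎

  module _ {m n} (C : Matrix m n) (κ : Fin m) (κ′ : Fin n) where

    clearing-zero : ∀ i j → j ≢ i → j ≢ κ → clearing C κ κ′ i j ≈ 0#
    clearing-zero i j j≢i j≢κ with i Fin.≟ j | j Fin.≟ κ
    ... | yes i≡j | _       = contradiction (≡.sym i≡j) j≢i
    ... | no  _   | yes j≡κ = contradiction j≡κ j≢κ
    ... | no  _   | no  _   = refl

    clearing-diagonal : ∀ i → clearing C κ κ′ i i ≈ 1#
    clearing-diagonal i with i Fin.≟ i | i Fin.≟ κ
    ... | yes _   | _ = refl
    ... | no  i≢i | _ = contradiction ≡.refl i≢i

    clearing-column : ∀ i → i ≢ κ → clearing C κ κ′ i κ ≈ - C i κ′
    clearing-column i i≢κ with i Fin.≟ κ | κ Fin.≟ κ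
    ... | yes i≡κ | _       = contradiction i≡κ i≢κ
    ... | no  _   | yes _   = refl
    ... | no  _   | no  κ≢κ = contradiction ≡.refl κ≢κ

    cleared-pivot : ∀ j → (clearing C κ κ′ · C) κ j ≈ C κ j
    cleared-pivot j = trans
      (sum-single _ κ λ t t≢κ → trans (*-congʳ (clearing-zero κ t t≢κ t≢κ)) (zeroˡ (C t j)))
      (trans (*-congʳ (clearing-diagonal κ)) (*-identityˡ (C κ j)))

    cleared-other : ∀ i j → i ≢ κ → (clearing C κ κ′ · C) i j ≈ C i j - C i κ′ * C κ j
    cleared-other i j i≢κ = trans
      (sum-pair _ i κ i≢κ λ t t≢i t≢κ → trans (*-congʳ (clearing-zero i t t≢i t≢κ)) (zeroˡ (C t j)))
      (+-cong (trans (*-congʳ (clearing-diagonal i)) (*-identityˡ (C i j)))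
              (trans (*-congʳ (clearing-column i i≢κ)) (sym (-‿distribˡ-* (C i κ′) (C κ j)))))

  -- Recovering A from A⁽²ᵏ⁾

  module _ {m n} {A : Matrix m n} where

    -- Clearing leaves the pivot row alone, and multiplying by the pivot undoes the scaling. With
    -- `even-other` this inverts one round of elimination.
    even-pivot : ∀ {k} (d : Defined A k) (p : Pivot (even d) k) j →
      even d (row p) j ≈ even d (row p) (col p) * even (step d p) (row p) j
    even-pivot d p j = sym (trans
      (*-congˡ (cleared-pivot (odd d p) (row p) (col p) j))
      (pivot*scaled p j))

    -- The multiple of the pivot row that clearing subtracts is added back. Its coefficient may be
    -- read in `even d`, since scaling changes no other row.
    even-other : ∀ {k} (d : Defined A k) (p : Pivot (even d) k) i j → i ≢ row p →
      even d i j ≈ even (step d p) i j + even d i (col p) * even (step d p) (row p) j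
    even-other d p i j i≢κ = sym (begin
      even (step d p) i j + even d i κ′ * even (step d p) κ j
        ≈⟨ +-cong (cleared-other C κ κ′ i j i≢κ)
             (*-cong (sym (scaled-other p i κ′ i≢κ)) (cleared-pivot C κ κ′ j)) ⟩
      C i j - C i κ′ * C κ j + C i κ′ * C κ j
        ≈⟨ trans (+-assoc _ _ _) (trans (+-congˡ (-‿inverseˡ _)) (+-identityʳ (C i j))) ⟩
      C i j
        ≈⟨ scaled-other p i j i≢κ ⟩
      even d i j ∎)
      where
      C = odd d p
      κ = row p
      κ′ = col p

    -- The part of E B that comes from the first `k` columns of E. The bounds are irrelevant
    -- arguments, so any proofs of them give the same matrix.
    leadingPart : ∀ {k} → Defined A k → .(k ≤ m) → .(k ≤ n) → Matrix m n
    leadingPart d k≤m k≤n i j = sum (λ t → A i (inject≤ t k≤n) * even d (inject≤ t k≤m) j)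

    module _ {k} (d : Defined A k) (p : Pivot (even d) k) where

      private
        κ = row p
        κ′ = col p
        B = even d
        B′ = even (step d p)
        k≤m = <⇒≤ (k<m p)
        k≤n = <⇒≤ (k<n p)

        -- The common part of the leading parts before and after the round. Each differs from it by
        -- a multiple of row `κ` of `B′`: the coefficient is `leadingPart d k≤m k≤n i κ′` before and
        -- `A i κ′` after.
        T : Matrix m n
        T i j = sum (λ t → A i (inject≤ t k≤n) * B′ (inject≤ t k≤m) j)

        lead≢κ : ∀ t → inject≤ t k≤m ≢ κ
        lead≢κ t eq = ℕ.<⇒≢ (Fin.toℕ<n t) (≡.trans (≡.sym (Fin.toℕ-inject≤ t k≤m))
          (≡.trans (≡.cong toℕ eq) (Fin.toℕ-fromℕ< (k<m p))))

      leadingPart-before : ∀ i j →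
        leadingPart d k≤m k≤n i j ≈ T i j + leadingPart d k≤m k≤n i κ′ * B′ κ j
      leadingPart-before i j = begin
        sum (λ t → A i (inject≤ t k≤n) * B (inject≤ t k≤m) j)
          ≈⟨ sum-cong-≋ (λ t → trans (*-congˡ (even-other d p (inject≤ t k≤m) j (lead≢κ t)))
               (solve 4 (λ a b c e → a :* (b :+ c :* e) := a :* b :+ a :* c :* e) refl
                 (A i (inject≤ t k≤n)) (B′ (inject≤ t k≤m) j) (B (inject≤ t k≤m) κ′) (B′ κ j))) ⟩
        sum (λ t → A i (inject≤ t k≤n) * B′ (inject≤ t k≤m) j
                 + A i (inject≤ t k≤n) * B (inject≤ t k≤m) κ′ * B′ κ j)
          ≈⟨ ∑-distrib-+ (λ t → A i (inject≤ t k≤n) * B′ (inject≤ t k≤m) j) _ ⟩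
        T i j + sum (λ t → A i (inject≤ t k≤n) * B (inject≤ t k≤m) κ′ * B′ κ j)
          ≈⟨ +-congˡ (*-distribʳ-sum (B′ κ j) (λ t → A i (inject≤ t k≤n) * B (inject≤ t k≤m) κ′)) ⟨
        T i j + leadingPart d k≤m k≤n i κ′ * B′ κ j ∎

      leadingPart-after : ∀ i j →
        leadingPart (step d p) (k<m p) (k<n p) i j ≈ T i j + A i κ′ * B′ κ j
      leadingPart-after i j = begin
        leadingPart (step d p) (k<m p) (k<n p) i j
          ≈⟨ sum-remove {i = fromℕ k} (λ t → A i (inject≤ t (k<n p)) * B′ (inject≤ t (k<m p)) j) ⟩
        A i (inject≤ (fromℕ k) (k<n p)) * B′ (inject≤ (fromℕ k) (k<m p)) j
          + sum (λ t → A i (inject≤ (punchIn (fromℕ k) t) (k<n p)) * B′ (inject≤ (punchIn (fromℕ k) t) (k<m p)) j)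
          ≡⟨ ≡.cong₂ _+_
               (≡.cong₂ (λ a b → A i a * B′ b j) (inject≤-fromℕ (k<n p)) (inject≤-fromℕ (k<m p)))
               (sum-cong-≗ λ t → ≡.cong₂ (λ a b → A i a * B′ b j)
                 (inject≤-punchIn-fromℕ (k<n p) k≤n t) (inject≤-punchIn-fromℕ (k<m p) k≤m t)) ⟩
        A i κ′ * B′ κ j + T i j
          ≈⟨ +-comm _ _ ⟩
        T i j + A i κ′ * B′ κ j ∎

    -- Together these are the equation A = E A⁽²ᵏ⁾.

    reconstruct-above : ∀ {k} (d : Defined A k) .(k≤m : k ≤ m) .(k≤n : k ≤ n) i j →
      toℕ i < k → A i j ≈ leadingPart d k≤m k≤n i j
    reconstruct-below : ∀ {k} (d : Defined A k) .(k≤m : k ≤ m) .(k≤n : k ≤ n) i j →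
      k ≤ toℕ i → A i j ≈ leadingPart d k≤m k≤n i j + even d i j

    -- The pivot row is the one that passes from the second equation to the first.
    reconstruct-above {suc k} (step d p) _ _ i j i<1+k with ℕ.m≤n⇒m<n∨m≡n (s≤s⁻¹ i<1+k)
    -- The hypothesis is used twice: in column `j`, and in the pivot column to turn the coefficient
    -- before the round into the one after it.
    ... | inj₁ i<k = begin
      A i j                       ≈⟨ reconstruct-above d _ _ i j i<k ⟩
      leadingPart d _ _ i j       ≈⟨ leadingPart-before d p i j ⟩
      _                           ≈⟨ +-congˡ (*-congʳ (reconstruct-above d _ _ i (col p) i<k)) ⟨
      _                           ≈⟨ leadingPart-after d p i j ⟨
      leadingPart (step d p) _ _ i j ∎
    -- Here the coefficient of the new pivot row is the leading part plus the pivot, which is the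
    -- entry of `A` in the pivot position by the second equation.
    ... | inj₂ i≡k with ≡.refl ← Fin.toℕ-injective (≡.trans i≡k (≡.sym (Fin.toℕ-fromℕ< (k<m p)))) = begin
      A κ j                       ≈⟨ reconstruct-below d _ _ κ j (ℕ.≤-reflexive (≡.sym i≡k)) ⟩
      leadingPart d _ _ κ j + even d κ j
                                  ≈⟨ +-cong (leadingPart-before d p κ j) (even-pivot d p j) ⟩
      _                           ≈⟨ solve 4 (λ t l b′ b → t :+ l :* b′ :+ b :* b′ := t :+ (l :+ b) :* b′) refl _ _ _ _ ⟩
      _                           ≈⟨ +-congˡ (*-congʳ (reconstruct-below d _ _ κ (col p) (ℕ.≤-reflexive (≡.sym i≡k)))) ⟨
      _                           ≈⟨ leadingPart-after d p κ j ⟨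
      leadingPart (step d p) _ _ κ j ∎
      where κ = row p

    -- At the start the leading part is an empty sum and `even start` is `A`.
    reconstruct-below start _ _ i j _ = sym (+-identityˡ (A i j))
    reconstruct-below (step d p) _ _ i j k<i = begin
      A i j                       ≈⟨ reconstruct-below d _ _ i j (<⇒≤ k<i) ⟩
      leadingPart d _ _ i j + even d i j
                                  ≈⟨ +-cong (leadingPart-before d p i j) (even-other d p i j i≢κ) ⟩
      _                           ≈⟨ solve 5 (λ t l b′ x b → t :+ l :* b′ :+ (x :+ b :* b′) := t :+ (l :+ b) :* b′ :+ x) refl _ _ _ _ _ ⟩
      _                           ≈⟨ +-congʳ (+-congˡ (*-congʳ (reconstruct-below d _ _ i (col p) (<⇒≤ k<i)))) ⟨
      _                           ≈⟨ +-congʳ (leadingPart-after d p i j) ⟨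
      leadingPart (step d p) _ _ i j + even (step d p) i j ∎
      where
      i≢κ : i ≢ row p
      i≢κ i≡κ = ℕ.<⇒≢ k<i (≡.trans (≡.sym (Fin.toℕ-fromℕ< (k<m p))) (≡.sym (≡.cong toℕ i≡κ)))

    -- The next column of A⁽²ᵏ⁾ and the minors of A

    module _ {k} (d : Defined A k) (k≤m : k ≤ m) (k<n : k < n) where

      private
        last = fromℕ k
        k≤n = <⇒≤ k<n
        κ′ = fromℕ< k<n

        x : Fin k → Carrier
        x t = even d (inject≤ t k≤m) κ′

        leadingPart-punchIn : ∀ i →
          leadingPart d k≤m k≤n i κ′ ≡ sum (λ t → A i (inject≤ (punchIn last t) k<n) * x t)
        leadingPart-punchIn i = sum-cong-≗ λ t →
          ≡.cong (λ j → A i j * x t) (≡.sym (inject≤-punchIn-fromℕ k<n k≤n t))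

      -- The reconstruction is read in a single column, with indices written through `last` and
      -- `punchIn last` to match `det-bordered` and `cramer`.
      nextColumn-above : ∀ i → toℕ i < k →
        A i (inject≤ last k<n) ≈ sum (λ t → A i (inject≤ (punchIn last t) k<n) * x t)
      nextColumn-above i i<k = begin
        A i (inject≤ last k<n)           ≡⟨ ≡.cong (A i) (inject≤-fromℕ k<n) ⟩
        A i κ′                           ≈⟨ reconstruct-above d k≤m k≤n i κ′ i<k ⟩
        leadingPart d k≤m k≤n i κ′       ≡⟨ leadingPart-punchIn i ⟩
        _                                ∎

      nextColumn-below : ∀ i → k ≤ toℕ i →
        A i (inject≤ last k<n) ≈ sum (λ t → A i (inject≤ (punchIn last t) k<n) * x t) + even d i κ′
      nextColumn-below i k≤i = begin
        A i (inject≤ last k<n)                        ≡⟨ ≡.cong (A i) (inject≤-fromℕ k<n) ⟩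
        A i κ′                                        ≈⟨ reconstruct-below d k≤m k≤n i κ′ k≤i ⟩
        leadingPart d k≤m k≤n i κ′ + even d i κ′      ≡⟨ ≡.cong (_+ even d i κ′) (leadingPart-punchIn i) ⟩
        _                                             ∎

      -- In the leading rows the last column is a combination of the earlier ones, and in row `i`
      -- the excess is `even d i κ′`, so `det-bordered` applies. The row list `ρ` stays abstract to
      -- cover both the next leading minor and borders further down.
      minor-below : ∀ i → k ≤ toℕ i → (ρ : Fin (suc k) → Fin m) →
        (∀ t → ρ (punchIn last t) ≡ leading k≤m t) → ρ last ≡ i →
        minor A ρ (leading k<n) ≈ leadingMinor A k≤m k≤n * even d i κ′
      minor-below i k≤i ρ ρ-leading ≡.refl = trans
        (det-bordered (λ s t → A (ρ s) (inject≤ t k<n)) x (even d i κ′)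
          (λ s → nextColumn-above (ρ (punchIn last s)) (lead<k s))
          (nextColumn-below i k≤i))
        (*-congʳ (det-cong λ s t →
          reflexive (≡.cong₂ A (ρ-leading s) (inject≤-punchIn-fromℕ k<n k≤n t))))
        where
        lead<k : ∀ s → toℕ (ρ (punchIn last s)) < k
        lead<k s = ≡.subst (_< k)
          (≡.sym (≡.trans (≡.cong toℕ (ρ-leading s)) (Fin.toℕ-inject≤ s k≤m))) (Fin.toℕ<n s)

    -- In the first `suc k` rows, the next column of `A` is a combination of the first `suc k`
    -- columns with coefficients from `even d`. Cramer's rule isolates the coefficient in row `i`.
    minor-above : ∀ {k} (d : Defined A (suc k)) (k<m : k < m) (1+k<n : suc k < n) i (i<1+k : toℕ i < suc k) →
      minor A (leading k<m) (removeAt (leading 1+k<n) (fromℕ< (m<n⇒m<1+n i<1+k)))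
      ≈ leadingMinor A k<m (<⇒≤ 1+k<n) * (ε ^ k * ε ^ toℕ i * even d i (fromℕ< 1+k<n))
    minor-above {k} d k<m 1+k<n i i<1+k = begin
      det (λ s → removeAt (N s) (fromℕ< (m<n⇒m<1+n i<1+k)))
        ≡⟨ ≡.cong (λ j → det (λ s → removeAt (N s) j)) position ⟩
      det (λ s → removeAt (N s) (punchIn last ι))
        ≈⟨ cramer N (λ t → even d (inject≤ t k<m) κ′) solution ι ⟩
      ε ^ k * (ε ^ toℕ ι * det (λ s → removeAt (N s) last) * even d (inject≤ ι k<m) κ′)
        ≈⟨ *-congˡ (*-cong
             (*-cong (reflexive (≡.cong (ε ^_) (Fin.toℕ-fromℕ< i<1+k)))
               (det-cong λ s t → reflexive (≡.cong (A (inject≤ s k<m)) (inject≤-punchIn-fromℕ 1+k<n (<⇒≤ 1+k<n) t))))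
             (reflexive (≡.cong (λ i → even d i κ′) ι≡i))) ⟩
      ε ^ k * (ε ^ toℕ i * mₖ * even d i κ′)
        ≈⟨ solve 4 (λ p q a b → p :* (q :* a :* b) := a :* (p :* q :* b)) refl
             (ε ^ k) (ε ^ toℕ i) mₖ (even d i κ′) ⟩
      mₖ * (ε ^ k * ε ^ toℕ i * even d i κ′) ∎
      where
      last = fromℕ (suc k)
      ι = fromℕ< i<1+k
      κ′ = fromℕ< 1+k<n
      mₖ = leadingMinor A k<m (<⇒≤ 1+k<n)
      N = λ s t → A (inject≤ s k<m) (inject≤ t 1+k<n)

      position : fromℕ< (m<n⇒m<1+n i<1+k) ≡ punchIn last ι
      position = Fin.toℕ-injective (≡.trans (Fin.toℕ-fromℕ< (m<n⇒m<1+n i<1+k))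
        (≡.sym (≡.trans (toℕ-punchIn-fromℕ ι) (Fin.toℕ-fromℕ< i<1+k))))

      ι≡i : inject≤ ι k<m ≡ i
      ι≡i = Fin.toℕ-injective (≡.trans (Fin.toℕ-inject≤ ι k<m) (Fin.toℕ-fromℕ< i<1+k))

      solution : ∀ s → N s last ≈ sum (λ t → N s (punchIn last t) * even d (inject≤ t k<m) κ′)
      solution s = nextColumn-above d k<m 1+k<n (inject≤ s k<m)
        (≡.subst (_< suc k) (≡.sym (Fin.toℕ-inject≤ s k<m)) (Fin.toℕ<n s))

    -- This is `minor-below` with the pivot row as the border.
    leadingMinor-step : ∀ {k} (d : Defined A k) (p : Pivot (even d) k) →
      leadingMinor A (k<m p) (k<n p) ≈ leadingMinor A (<⇒≤ (k<m p)) (<⇒≤ (k<n p)) * even d (row p) (col p)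
    leadingMinor-step d p = minor-below d (<⇒≤ (k<m p)) (k<n p) (row p)
      (ℕ.≤-reflexive (≡.sym (Fin.toℕ-fromℕ< (k<m p)))) (leading (k<m p))
      (inject≤-punchIn-fromℕ (k<m p) (<⇒≤ (k<m p))) (inject≤-fromℕ (k<m p))

    -- By `leadingMinor-step` a leading minor is the product of the pivots met so far, each of them
    -- apart from 0.
    leadingMinor#0 : ∀ {k} → Defined A k → (k≤m : k ≤ m) (k≤n : k ≤ n) → leadingMinor A k≤m k≤n # 0#
    leadingMinor#0 start      _ _ = 1#0
    leadingMinor#0 (step d p) _ _ = #-congʳ (sym (leadingMinor-step d p))
      (x#0y#0→xy#0 (leadingMinor#0 d (<⇒≤ (k<m p)) (<⇒≤ (k<n p))) (Pivot.nonzero p))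

  -- Entries of the operation matrices as quotients of minors

  ÷-unique : ∀ {x y z} (y#0 : y # 0#) → x ≈ y * z → z ≈ x ÷ y [ y#0 ]
  ÷-unique {x} {y} {z} y#0 x≈yz = sym (begin
    x * y⁻¹          ≈⟨ *-congʳ x≈yz ⟩
    y * z * y⁻¹      ≈⟨ solve 3 (λ y z w → y :* z :* w := z :* (y :* w)) refl y z y⁻¹ ⟩
    z * (y * y⁻¹)    ≈⟨ *-congˡ (*-reciprocal y y#0) ⟩
    z * 1#           ≈⟨ *-identityʳ z ⟩
    z                ∎)
    where y⁻¹ = reciprocal y y#0

  module _ {m n k} {A : Matrix m n} (d : Defined A k) (p : Pivot (even d) k) where

    -- Since `mₖ₊₁` is `mₖ` times the pivot, multiplying it by the reciprocal of the pivot gives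
    -- back `mₖ`.
    𝒢₂ₖ₊₁-pivot :
      let mₖ   = leadingMinor A (<⇒≤ (k<m p)) (<⇒≤ (k<n p))
          mₖ₊₁ = leadingMinor A (k<m p) (k<n p)
      in (mₖ₊₁#0 : mₖ₊₁ # 0#) → 𝒢₂ₖ₊₁ d p (row p) (row p) ≈ mₖ ÷ mₖ₊₁ [ mₖ₊₁#0 ]
    𝒢₂ₖ₊₁-pivot mₖ₊₁#0 = trans (scaling-pivot p) (÷-unique mₖ₊₁#0 (begin
      mₖ                                 ≈⟨ *-identityʳ mₖ ⟨
      mₖ * 1#                            ≈⟨ *-congˡ (*-reciprocal pivot (Pivot.nonzero p)) ⟨
      mₖ * (pivot * pivot⁻¹)             ≈⟨ *-assoc mₖ pivot pivot⁻¹ ⟨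
      mₖ * pivot * pivot⁻¹               ≈⟨ *-congʳ (leadingMinor-step d p) ⟨
      mₖ₊₁ * pivot⁻¹                     ∎))
      where
      mₖ = leadingMinor A (<⇒≤ (k<m p)) (<⇒≤ (k<n p))
      mₖ₊₁ = leadingMinor A (k<m p) (k<n p)
      pivot = even d (row p) (col p)
      pivot⁻¹ = reciprocal pivot (Pivot.nonzero p)

    -- The clearing matrix is read off A⁽²ᵏ⁺¹⁾, which agrees with A⁽²ᵏ⁾ outside the pivot row.
    𝒢₂ₖ₊₂-column : ∀ i → toℕ i ≢ k → 𝒢₂ₖ₊₂ d p i (row p) ≈ - even d i (col p)
    𝒢₂ₖ₊₂-column i i≢k = trans
      (clearing-column (odd d p) (row p) (col p) i i≢κ) (-‿cong (scaled-other p i (col p) i≢κ))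
      where
      i≢κ : i ≢ row p
      i≢κ i≡κ = i≢k (≡.trans (≡.cong toℕ i≡κ) (Fin.toℕ-fromℕ< (k<m p)))

    𝒢₂ₖ₊₂-below :
      let k≤m = <⇒≤ (k<m p)
          mₖ  = leadingMinor A k≤m (<⇒≤ (k<n p))
      in (mₖ#0 : mₖ # 0#) → ∀ i → k < toℕ i →
      𝒢₂ₖ₊₂ d p i (row p) ≈ - (minor A (insertAt (leading k≤m) (fromℕ k) i) (leading (k<n p)) ÷ mₖ [ mₖ#0 ])
    𝒢₂ₖ₊₂-below mₖ#0 i k<i = trans (𝒢₂ₖ₊₂-column i (ℕ.>⇒≢ k<i)) (-‿cong (÷-unique mₖ#0
      -- Inserting `i` at position `fromℕ k` appends it to the leading rows as the border.
      (minor-below d k≤m (k<n p) i (<⇒≤ k<i) (insertAt (leading k≤m) (fromℕ k) i)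
        (insertAt-punchIn-fromℕ (leading k≤m) i) (insertAt-fromℕ (leading k≤m) i))))
      where k≤m = <⇒≤ (k<m p)

  -- The exponents add up to 2k + 2i + 3, which is odd. One successor comes from the 0-based row
  -- index, the other from `k` being a successor in `𝒢₂ₖ₊₂-above`.
  ε^[1+k+1+i+1]*ε^k*ε^i : ∀ k i b → ε ^ (suc k +ℕ suc i +ℕ 1) * (ε ^ k * ε ^ i * b) ≈ ε * b
  ε^[1+k+1+i+1]*ε^k*ε^i k i b = begin
    ε ^ (suc k +ℕ suc i +ℕ 1) * (ε ^ k * ε ^ i * b)
      ≈⟨ *-congʳ (trans (^-homo-* ε (suc k +ℕ suc i) 1) (*-congʳ (^-homo-* ε (suc k) (suc i)))) ⟩
    ε * ε ^ k * (ε * ε ^ i) * (ε * 1#) * (ε ^ k * ε ^ i * b)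
      ≈⟨ solve 4 (λ e p q b → e :* p :* (e :* q) :* (e :* con 1) :* (p :* q :* b)
                           := e :* e :* (p :* p) :* (q :* q) :* (e :* b))
           refl ε (ε ^ k) (ε ^ i) b ⟩
    ε * ε * (ε ^ k * ε ^ k) * (ε ^ i * ε ^ i) * (ε * b)
      ≈⟨ *-congʳ (*-cong (*-cong ε*ε≈1 (ε^n*ε^n≈1 k)) (ε^n*ε^n≈1 i)) ⟩
    1# * 1# * 1# * (ε * b)
      ≈⟨ solve 1 (λ x → con 1 :* con 1 :* con 1 :* x := x) refl (ε * b) ⟩
    ε * b ∎

  𝒢₂ₖ₊₂-above : ∀ {m n k} {A : Matrix m n} (d : Defined A k) (p : Pivot (even d) k) →
    let mₖ = leadingMinor A (<⇒≤ (k<m p)) (<⇒≤ (k<n p)) in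
    (mₖ#0 : mₖ # 0#) → ∀ i (i<k : toℕ i < k) →
    𝒢₂ₖ₊₂ d p i (row p) ≈ (- 1#) ^ (k +ℕ suc (toℕ i) +ℕ 1)
      * (minor A (leading (<⇒≤ (k<m p))) (removeAt (leading (k<n p)) (fromℕ< (m<n⇒m<1+n i<k))) ÷ mₖ [ mₖ#0 ])
  -- Only a successor is possible here, because some row lies above the pivot row.
  𝒢₂ₖ₊₂-above {k = suc k} {A} d p mₖ#0 i i<k = begin
    𝒢₂ₖ₊₂ d p i (row p)
      ≈⟨ trans (𝒢₂ₖ₊₂-column d p i (ℕ.<⇒≢ i<k)) (sym (-1*x≈-x b)) ⟩
    ε * b
      ≈⟨ ε^[1+k+1+i+1]*ε^k*ε^i k (toℕ i) b ⟨
    ε ^ (suc k +ℕ suc (toℕ i) +ℕ 1) * (ε ^ k * ε ^ toℕ i * b)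
      ≈⟨ *-congˡ (÷-unique mₖ#0 (minor-above d (<⇒≤ (k<m p)) (k<n p) i i<k)) ⟩
    _ ∎
    where b = even d i (col p)

-- The formulas over the real numbers

open HeytingField ℝ-heytingField using (_≈_; _#_; _*_; -_; 0#; 1#)
open LinearAlgebra ℝ-heytingField
open GaussJordan ℝ-heytingField

theorem2p7 :
    ∀ {m n} (A : Matrix m n) (r : ℕ) →
    HasRank A r → 1 < r → (eliminable : DiagonallyEliminable A r) →
    ∀ k (k<r : k < r) →
    let d , p = eliminable k k<r
        G₁    = 𝒢₂ₖ₊₁ d p
        G₂    = 𝒢₂ₖ₊₂ d p
        κ     = row p
        k≤m   = <⇒≤ (k<m p)
        k≤n   = <⇒≤ (k<n p)
        mₖ    = leadingMinor A k≤m k≤n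
        mₖ₊₁  = leadingMinor A (k<m p) (k<n p)
    in
    Σ[ mₖ#0 ∈ mₖ # 0# ] Σ[ mₖ₊₁#0 ∈ mₖ₊₁ # 0# ]
    ( (∀ i j → i ≢ j → G₁ i j ≈ 0#)
    × (∀ i → i ≢ κ → G₁ i i ≈ 1#)
    × (G₁ κ κ ≈ mₖ ÷ mₖ₊₁ [ mₖ₊₁#0 ])
    × (∀ i j → j ≢ i → j ≢ κ → G₂ i j ≈ 0#)
    × (∀ i → G₂ i i ≈ 1#)
      -- the 0-based row i is row i+1 of the matrix
    × (∀ i (i<k : toℕ i < k) →
         G₂ i κ ≈ (- 1#) ^ (k +ℕ suc (toℕ i) +ℕ 1)
                  * (minor A (leading k≤m)
                             (removeAt (leading (k<n p)) (fromℕ< (m<n⇒m<1+n i<k)))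
                     ÷ mₖ [ mₖ#0 ]))
    × (∀ i → k < toℕ i →
         G₂ i κ ≈ - (minor A (insertAt (leading k≤m) (fromℕ k) i) (leading (k<n p))
                     ÷ mₖ [ mₖ#0 ])) )
theorem2p7 A r _ _ eliminable k k<r =
  let d , p  = eliminable k k<r
      mₖ#0   = leadingMinor#0 d (<⇒≤ (k<m p)) (<⇒≤ (k<n p))
      -- The pivot `p` extends the elimination by one round, which yields the apartness of the next
      -- leading minor.
      mₖ₊₁#0 = leadingMinor#0 (step d p) (k<m p) (k<n p)
  in mₖ#0 , mₖ₊₁#0
    , scaling-offDiagonal p
    , scaling-diagonal p
    , 𝒢₂ₖ₊₁-pivot d p mₖ₊₁#0
    , clearing-zero (odd d p) (row p) (col p)
    , clearing-diagonal (odd d p) (row p) (col p)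
    , 𝒢₂ₖ₊₂-above d p mₖ#0
    , 𝒢₂ₖ₊₂-below d p mₖ#0
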